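{- Let $a,b,m$ be integers with $2\le a\le b$ and $1\le m\le b$, and let $G$ be a connected graph of order $n\ge 4a+\frac{5b}{2}+4m+7$ with minimum degree $\delta(G)\ge a+m$. If $$e(G)\ge \binom{n-b-1}{2}+ab+2a+(b+1)m,$$ then $G$ is a fractional $(a,b,m)$-covered graph.
   Context: All graphs are finite, simple and undirected; $e(G)$ is the number of edges of $G$. For a function $h:E(G)\to[0,1]$, let $E_h=\{e\in E(G): h(e)>0\}$; if $a\le \sum_{e\ni u} h(e)\le b$ for every vertex $u\in V(G)$ (sum over edges incident with $u$), then $G[E_h]$ is a fractional $[a,b]$-factor of $G$ with indicator function $h$. A graph $G$ is a fractional $(a,b,m)$-covered graph if for every subgraph $H\subseteq G$ with $|E(H)|=m$ there exists a fractional $[a,b]$-factor of $G$ with indicator function $h$ such that $h(e)=1$ for every $e\in E(H)$. -}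

module Defs where

open import Data.Nat using (ℕ; zero; suc; _+_)
open import Data.Fin using (Fin; zero; suc; _<_)
open import Data.Bool using (Bool; true; false; T)
open import Data.Product using (Σ; _×_; _,_)
open import Relation.Binary.PropositionalEquality using (_≡_)
open import Relation.Nullary using (¬_; Dec; yes; no)
open import Data.Rational as ℚ using (ℚ; 0ℚ; 1ℚ)
open import Data.Integer using (+_)

Σℕ : (n : ℕ) → (Fin n → ℕ) → ℕ
Σℕ zero f = 0
Σℕ (suc n) f = f zero + Σℕ n (λ i → f (suc i))

Σℚ : (n : ℕ) → (Fin n → ℚ) → ℚ
Σℚ zero f = 0ℚ
Σℚ (suc n) f = f zero ℚ.+ Σℚ n (λ i → f (suc i))

record Graph (n : ℕ) : Set where
  field
    adj   : Fin n → Fin n → Bool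
    sym   : ∀ u v → adj u v ≡ adj v u
    irref : ∀ u → adj u u ≡ false
open Graph public

bit : Bool → ℕ
bit true = 1
bit false = 0

deg : ∀ {n} → Graph n → Fin n → ℕ
deg {n} G u = Σℕ n (λ v → bit (adj G u v))

ltBit : ∀ {n} → Fin n → Fin n → ℕ
ltBit u v with Data.Fin._<?_ u v
... | yes _ = 1
... | no _ = 0

numEdges : ∀ {n} → Graph n → ℕ
numEdges {n} G = Σℕ n (λ u → Σℕ n (λ v → ltBit u v Data.Nat.* bit (adj G u v)))

data Reach {n : ℕ} (G : Graph n) : Fin n → Fin n → Set where
  here : ∀ {u} → Reach G u u
  step : ∀ {u v w} → T (adj G u v) → Reach G v w → Reach G u w

Connected : ∀ {n} → Graph n → Set
Connected {n} G = ∀ (u v : Fin n) → Reach G u v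

record SubgraphEdges {n : ℕ} (G : Graph n) : Set where
  field
    hadj  : Fin n → Fin n → Bool
    hsym  : ∀ u v → hadj u v ≡ hadj v u
    hsub  : ∀ u v → T (hadj u v) → T (adj G u v)
open SubgraphEdges public

numSubEdges : ∀ {n} {G : Graph n} → SubgraphEdges G → ℕ
numSubEdges {n} H = Σℕ n (λ u → Σℕ n (λ v → ltBit u v Data.Nat.* bit (hadj H u v)))

-- h : E(G) → [0,1], represented as a symmetric function on pairs; only its
-- values on edges of G matter.
record IndicatorFunction {n : ℕ} (G : Graph n) : Set where
  field
    h      : Fin n → Fin n → ℚ
    h-sym  : ∀ u v → h u v ≡ h v u
    h-lo   : ∀ u v → T (adj G u v) → 0ℚ ℚ.≤ h u v
    h-hi   : ∀ u v → T (adj G u v) → h u v ℚ.≤ 1ℚ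
open IndicatorFunction public

hSum : ∀ {n} {G : Graph n} → IndicatorFunction G → Fin n → ℚ
hSum {n} {G} f u = Σℚ n (λ v → if adj G u v then h f u v else 0ℚ)
  where open import Data.Bool using (if_then_else_)

IsFractionalFactor : ∀ {n} (G : Graph n) → ℕ → ℕ → IndicatorFunction G → Set
IsFractionalFactor {n} G a b f =
  ∀ (u : Fin n) → ((+ a ℚ./ 1) ℚ.≤ hSum f u) × (hSum f u ℚ.≤ (+ b ℚ./ 1))

FractionalCovered : ∀ {n} (G : Graph n) → ℕ → ℕ → ℕ → Set
FractionalCovered G a b m =
  ∀ (H : SubgraphEdges G) → numSubEdges H ≡ m →
    Σ (IndicatorFunction G) λ f →
      IsFractionalFactor G a b f ×
      (∀ u v → T (hadj H u v) → h f u v ≡ 1ℚ)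

{-# OPTIONS --safe #-}
module Submission where

-- Doubling the graph G − E(H) to a bipartite graph, it suffices to find a 0/1
-- matrix x supported on G − E(H) whose row and column sums at v lie between
-- a − d_H(v) and b − d_H(v); then h = 1 on H and h(uv) = (x(u,v) + x(v,u))/2
-- elsewhere.  By augmenting alternating paths, x exists as soon as
--   Σ_{v∈U} (a − d_H(v)) ≤ Σ_{v∈S} (b − d_H(v)) + e(U, V∖S)   for all S, U,
-- and one may take S and U disjoint.  This follows from
--   Σ_{v∉S} max(0, a − d_{G−S}(v)) + Σ_{v∈S} d_H(v) ≤ b|S|.
-- Let T be the set of v ∉ S with d_{G−S}(v) < a.  For |T| ≤ b the minimum degree
-- suffices.  For |T| = b + 1 + k a failure bounds Σ_{v∈T} d_{G−S}(v) from above,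
-- and hence e(G), since every edge lies outside T or is counted at an end in T;
-- this contradicts the lower bound on e(G).

open import Defs
open import Data.Bool using (Bool; true; false; not; _∧_; if_then_else_; T)
import Data.Bool.Properties as Boolₚ
open import Data.Fin as Fin using (Fin; zero; suc)
import Data.Fin.Properties as Finₚ
open import Data.Integer as ℤ using ()
import Data.Integer.Properties as ℤₚ
open import Data.Nat using (ℕ; zero; suc; _+_; _*_; _∸_; _≤_; _<_; z≤n; s≤s; _<?_; _≤?_; _<ᵇ_)
open import Data.Nat.Combinatorics using (_C_; nC1≡n; nCk+nC[k+1]≡[n+1]C[k+1])
open import Data.Nat.Induction using (<-wellFounded)
open import Data.Nat.Properties
open import Data.Nat.Tactic.RingSolver using (solve-∀)
open import Data.Product using (Σ; ∃₂; _×_; _,_; proj₁; proj₂)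
open import Data.Rational as ℚ using (ℚ; 0ℚ; 1ℚ)
import Data.Rational.Properties as ℚₚ
open import Data.Rational.Unnormalised as ℚᵘ using (mkℚᵘ; *≡*; *≤*)
import Data.Rational.Unnormalised.Properties as ℚᵘₚ
open import Data.Sum using (_⊎_; inj₁; inj₂)
open import Induction.WellFounded using (Acc; acc)
open import Relation.Binary.Definitions using (tri<; tri≈; tri>)
open import Relation.Binary.PropositionalEquality using (_≡_; _≢_; refl; trans; cong; cong₂; subst; module ≡-Reasoning)
import Relation.Binary.PropositionalEquality as ≡
open import Relation.Nullary using (¬_; Dec; yes; no; does; contradiction)
open import Relation.Nullary.Decidable using (_×-dec_)

-- Finite sums

Σ-cong : ∀ n {f g : Fin n → ℕ} → (∀ i → f i ≡ g i) → Σℕ n f ≡ Σℕ n g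
Σ-cong zero    eq = refl
Σ-cong (suc n) eq = cong₂ _+_ (eq zero) (Σ-cong n (λ i → eq (suc i)))

Σ-mono-≤ : ∀ n {f g : Fin n → ℕ} → (∀ i → f i ≤ g i) → Σℕ n f ≤ Σℕ n g
Σ-mono-≤ zero    le = z≤n
Σ-mono-≤ (suc n) le = +-mono-≤ (le zero) (Σ-mono-≤ n (λ i → le (suc i)))

Σ-mono-< : ∀ n {f g : Fin n → ℕ} → (∀ i → f i ≤ g i) → ∀ k → f k < g k → Σℕ n f < Σℕ n g
Σ-mono-< (suc n) le zero    lt = +-mono-<-≤ lt (Σ-mono-≤ n (λ i → le (suc i)))
Σ-mono-< (suc n) le (suc k) lt = +-mono-≤-< (le zero) (Σ-mono-< n (λ i → le (suc i)) k lt)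

Σ-+ : ∀ n (f g : Fin n → ℕ) → Σℕ n (λ i → f i + g i) ≡ Σℕ n f + Σℕ n g
Σ-+ zero    f g = refl
Σ-+ (suc n) f g rewrite Σ-+ n (λ i → f (suc i)) (λ i → g (suc i)) =
  interchange (f zero) (g zero) _ _
  where
  interchange : ∀ p q r s → p + q + (r + s) ≡ p + r + (q + s)
  interchange = solve-∀

Σ-*ˡ : ∀ n c (f : Fin n → ℕ) → Σℕ n (λ i → c * f i) ≡ c * Σℕ n f
Σ-*ˡ zero    c f = ≡.sym (*-zeroʳ c)
Σ-*ˡ (suc n) c f = trans (cong (c * f zero +_) (Σ-*ˡ n c (λ i → f (suc i)))) (≡.sym (*-distribˡ-+ c (f zero) _))

Σ-const : ∀ n c → Σℕ n (λ _ → c) ≡ n * c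
Σ-const zero    c = refl
Σ-const (suc n) c = cong (c +_) (Σ-const n c)

Σ-zero : ∀ n → Σℕ n (λ _ → 0) ≡ 0
Σ-zero n = trans (Σ-const n 0) (*-zeroʳ n)

Σ-swap : ∀ m n (f : Fin m → Fin n → ℕ) →
         Σℕ m (λ i → Σℕ n (f i)) ≡ Σℕ n (λ j → Σℕ m (λ i → f i j))
Σ-swap zero    n f = ≡.sym (Σ-zero n)
Σ-swap (suc m) n f = trans (cong (Σℕ n (f zero) +_) (Σ-swap m n (λ i → f (suc i))))
                           (≡.sym (Σ-+ n (f zero) _))

term≤Σ : ∀ n (f : Fin n → ℕ) i → f i ≤ Σℕ n f
term≤Σ (suc n) f zero    = m≤m+n _ _
term≤Σ (suc n) f (suc i) = ≤-trans (term≤Σ n (λ i → f (suc i)) i) (m≤n+m _ (f zero))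

δ : ∀ {n} → Fin n → Fin n → ℕ
δ i j = bit (does (i Fin.≟ j))

δ-refl : ∀ {n} (i : Fin n) → δ i i ≡ 1
δ-refl i with i Fin.≟ i
... | yes _  = refl
... | no i≢i = contradiction refl i≢i

δ-≢ : ∀ {n} {i j : Fin n} → i ≢ j → δ i j ≡ 0
δ-≢ {i = i} {j} i≢j with i Fin.≟ j
... | yes i≡j = contradiction i≡j i≢j
... | no _    = refl

Σ-δ : ∀ n (k : Fin n) → Σℕ n (λ i → δ i k) ≡ 1
Σ-δ (suc n) zero    = cong suc (Σ-zero n)
Σ-δ (suc n) (suc k) = Σ-δ n k

bit≤1 : ∀ p → bit p ≤ 1
bit≤1 true  = ≤-refl
bit≤1 false = z≤n

bit-complement : ∀ p → bit p + bit (not p) ≡ 1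
bit-complement true  = refl
bit-complement false = refl

∣_∣ ∣_∣ᶜ : ∀ {n} → (Fin n → Bool) → ℕ
∣_∣ {n} S = Σℕ n (λ i → bit (S i))
∣_∣ᶜ {n} S = Σℕ n (λ i → bit (not (S i)))

∣S∣+∣S∣ᶜ≡n : ∀ {n} (S : Fin n → Bool) → ∣ S ∣ + ∣ S ∣ᶜ ≡ n
∣S∣+∣S∣ᶜ≡n {n} S = begin
  ∣ S ∣ + ∣ S ∣ᶜ                             ≡⟨ Σ-+ n _ _ ⟨
  Σℕ n (λ i → bit (S i) + bit (not (S i)))   ≡⟨ Σ-cong n (λ i → bit-complement (S i)) ⟩
  Σℕ n (λ _ → 1)                             ≡⟨ Σ-const n 1 ⟩
  n * 1                                      ≡⟨ *-identityʳ n ⟩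
  n                                          ∎
  where open ≡-Reasoning

ΣΣ-+ : ∀ n (f g : Fin n → Fin n → ℕ) →
       Σℕ n (λ i → Σℕ n (λ j → f i j + g i j)) ≡
       Σℕ n (λ i → Σℕ n (f i)) + Σℕ n (λ i → Σℕ n (g i))
ΣΣ-+ n f g = trans (Σ-cong n (λ i → Σ-+ n (f i) (g i))) (Σ-+ n _ _)

ltBit-split : ∀ {n} (f : Fin n → Fin n → ℕ) → (∀ u v → f u v ≡ f v u) → (∀ u → f u u ≡ 0) →
              ∀ u v → f u v ≡ ltBit u v * f u v + ltBit v u * f v u
ltBit-split f f-sym f-irr u v with u Fin.<? v | v Fin.<? u
... | yes u<v | yes v<u = contradiction v<u (<⇒≯ u<v)
... | yes _   | no _    = ≡.sym (trans (+-identityʳ _) (+-identityʳ _))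
... | no _    | yes _   = trans (f-sym u v) (≡.sym (+-identityʳ _))
... | no u≮v  | no v≮u  with Finₚ.<-cmp u v
... | tri< u<v _ _ = contradiction u<v u≮v
... | tri> _ _ v<u = contradiction v<u v≮u
... | tri≈ _ refl _ = f-irr u

-- Each unordered pair occurs twice among the ordered pairs, and `ltBit-split` charges each
-- occurrence to its increasing orientation. The weight is arbitrary so that the identity serves
-- both `G` and `H`.
handshake : ∀ n (f : Fin n → Fin n → ℕ) → (∀ u v → f u v ≡ f v u) → (∀ u → f u u ≡ 0) →
            Σℕ n (λ u → Σℕ n (f u)) ≡ 2 * Σℕ n (λ u → Σℕ n (λ v → ltBit u v * f u v))
handshake n f f-sym f-irr = begin
  Σℕ n (λ u → Σℕ n (f u))
    ≡⟨ Σ-cong n (λ u → Σ-cong n (ltBit-split f f-sym f-irr u)) ⟩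
  Σℕ n (λ u → Σℕ n (λ v → ltBit u v * f u v + ltBit v u * f v u))
    ≡⟨ ΣΣ-+ n _ _ ⟩
  e + Σℕ n (λ u → Σℕ n (λ v → ltBit v u * f v u))
    ≡⟨ cong (e +_) (Σ-swap n n (λ u v → ltBit v u * f v u)) ⟩
  e + e
    ≡⟨ cong (e +_) (+-identityʳ e) ⟨
  2 * e ∎
  where
  open ≡-Reasoning
  e = Σℕ n (λ u → Σℕ n (λ v → ltBit u v * f u v))

-- Factors of bipartite double covers

Rel : ℕ → Set
Rel n = Fin n → Fin n → Bool

_ᵀ : ∀ {n} → Rel n → Rel n
(x ᵀ) u v = x v u

out inn : ∀ {n} → Rel n → Fin n → ℕ
out {n} x u = Σℕ n (λ v → bit (x u v))
inn x = out (x ᵀ)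

_⊆_ : ∀ {n} → Rel n → Rel n → Set
x ⊆ E = ∀ u v → x u v ≡ true → E u v ≡ true

add : ∀ {n} → Fin n → (Fin n → Bool) → Fin n → Bool
add u R i = if does (i Fin.≟ u) then true else R i

∈-add : ∀ {n} u (R : Fin n → Bool) → add u R u ≡ true
∈-add u R with u Fin.≟ u
... | yes _  = refl
... | no u≢u = contradiction refl u≢u

⊆-add : ∀ {n} u (R : Fin n → Bool) i → add u R i ≡ false → R i ≡ false
⊆-add u R i eq with i Fin.≟ u | eq
... | no _ | eq′ = eq′

∈-add⁻ : ∀ {n} u (R : Fin n → Bool) i → add u R i ≡ true → i ≡ u ⊎ R i ≡ true
∈-add⁻ u R i eq with i Fin.≟ u | eq
... | yes i≡u | _   = inj₁ i≡u
... | no _    | eq′ = inj₂ eq′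

∣add∣ᶜ : ∀ {n} u (R : Fin n → Bool) → R u ≡ false → ∣ add u R ∣ᶜ < ∣ R ∣ᶜ
∣add∣ᶜ {n} u R u∉R = Σ-mono-< n le u lt
  where
  le : ∀ i → bit (not (add u R i)) ≤ bit (not (R i))
  le i with i Fin.≟ u
  ... | yes _ = z≤n
  ... | no _  = ≤-refl
  lt : bit (not (add u R u)) < bit (not (R u))
  lt rewrite ∈-add u R | u∉R = ≤-refl

set : ∀ {n} → Rel n → Fin n → Fin n → Bool → Rel n
set x w v p i j = if does (i Fin.≟ w) ∧ does (j Fin.≟ v) then p else x i j

set-agree : ∀ {n} (x : Rel n) w v p i j → i ≢ w ⊎ j ≢ v → set x w v p i j ≡ x i j
set-agree x w v p i j ne with i Fin.≟ w | j Fin.≟ v | ne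
... | yes i≡w | yes j≡v | inj₁ i≢w = contradiction i≡w i≢w
... | yes i≡w | yes j≡v | inj₂ j≢v = contradiction j≡v j≢v
... | yes _   | no _    | _        = refl
... | no _    | _       | _        = refl

-- `y` is `x` without the pair `(w , v)`, phrased through counts so that row and column sums follow
-- by summation. Adding a pair is the same relation read backwards.
Minus : ∀ {n} → Rel n → Rel n → Fin n → Fin n → Set
Minus y x w v = ∀ i j → bit (x i j) ≡ bit (y i j) + δ i w * δ j v

set-true : ∀ {n} (x : Rel n) w v → x w v ≡ false → Minus x (set x w v true) w v
set-true x w v xwv i j with i Fin.≟ w | j Fin.≟ v
... | yes refl | yes refl rewrite xwv = refl
... | yes _    | no _     = ≡.sym (+-identityʳ _)
... | no _     | _        = ≡.sym (+-identityʳ _)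

set-false : ∀ {n} (x : Rel n) w v → x w v ≡ true → Minus (set x w v false) x w v
set-false x w v xwv i j with i Fin.≟ w | j Fin.≟ v
... | yes refl | yes refl rewrite xwv = refl
... | yes _    | no _     = ≡.sym (+-identityʳ _)
... | no _     | _        = ≡.sym (+-identityʳ _)

Minus-out : ∀ {n} {y x : Rel n} {w v} → Minus y x w v → ∀ i → out x i ≡ out y i + δ i w
Minus-out {n} {y} {x} {w} {v} mn i = begin
  out x i                                        ≡⟨ Σ-cong n (mn i) ⟩
  Σℕ n (λ j → bit (y i j) + δ i w * δ j v)       ≡⟨ Σ-+ n _ _ ⟩
  out y i + Σℕ n (λ j → δ i w * δ j v)           ≡⟨ cong (out y i +_) (Σ-*ˡ n (δ i w) _) ⟩
  out y i + δ i w * Σℕ n (λ j → δ j v)           ≡⟨ cong (λ e → out y i + δ i w * e) (Σ-δ n v) ⟩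
  out y i + δ i w * 1                            ≡⟨ cong (out y i +_) (*-identityʳ _) ⟩
  out y i + δ i w                                ∎
  where open ≡-Reasoning

Minus-inn : ∀ {n} {y x : Rel n} {w v} → Minus y x w v → ∀ j → inn x j ≡ inn y j + δ j v
Minus-inn {y = y} {x} {w} {v} mn =
  Minus-out {y = y ᵀ} {x ᵀ} {v} {w} (λ i j → trans (mn j i) (cong (bit (y j i) +_) (*-comm (δ j w) (δ i v))))

-- Repairing one deficient row by an alternating path

module Augment {n : ℕ} (E : Rel n) (lo hi : Fin n → ℕ) (lo≤hi : ∀ i → lo i ≤ hi i) where

  record Feasible (x : Rel n) : Set where
    field
      sub    : x ⊆ E
      out≤hi : ∀ i → out x i ≤ hi i
      inn≤hi : ∀ j → inn x j ≤ hi j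
  open Feasible public

  -- Hoffman's condition for the bipartite double cover of E.
  CutCondition : Set
  CutCondition = ∀ (S U : Fin n → Bool) →
    Σℕ n (λ v → bit (U v) * lo v) ≤
    Σℕ n (λ v → bit (S v) * hi v) + Σℕ n (λ v → Σℕ n (λ w → bit (U v) * bit (E v w) * bit (not (S w))))

  -- Deficits are compared rather than sums, because a path may end by taking a unit from a row that
  -- has more than `lo`.
  record Improvement (x : Rel n) (u : Fin n) : Set where
    field
      next     : Rel n
      feasible : Feasible next
      out-def  : ∀ i → lo i ∸ out next i ≤ lo i ∸ out x i
      out-def< : lo u ∸ out next u < lo u ∸ out x u
      inn-def  : ∀ j → lo j ∸ inn next j ≤ lo j ∸ inn x j
  open Improvement public

  module Search (cut : CutCondition) (x : Rel n) (fx : Feasible x) (u : Fin n) (deficient : out x u < lo u) where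

    -- An exit pair `(w , v)` of the search has `w` outside `R` or `v` outside `K`. Agreement with
    -- `x` there determines its value in the augmented relation.
    Agree : (R K : Fin n → Bool) → Rel n → Set
    Agree R K y = ∀ i j → R i ≡ false ⊎ K j ≡ false → y i j ≡ x i j

    -- The result of augmenting x along an alternating path from row u to row w
    -- (resp. column v) inside R × K.  Keeping the augmented relation instead of
    -- the path removes any need to discuss paths.
    record RowReached (R K : Fin n → Bool) (w : Fin n) : Set where
      field
        y     : Rel n
        sub   : y ⊆ E
        agree : Agree R K y
        outs  : ∀ i → out y i + δ i w ≡ out x i + δ i u
        inns  : ∀ j → inn y j ≡ inn x j

    record ColReached (R K : Fin n → Bool) (v : Fin n) : Set where
      field
        y     : Rel n
        sub   : y ⊆ E
        agree : Agree R K y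
        outs  : ∀ i → out y i ≡ out x i + δ i u
        inns  : ∀ j → inn y j ≡ inn x j + δ j v

    -- `R` and `K` are the rows and columns reached so far. Reached rows have no unit to spare and
    -- reached columns no room, since otherwise the search would already have ended in an
    -- improvement.
    record Visited (R K : Fin n → Bool) : Set where
      field
        root : R u ≡ true
        rows  : ∀ w → R w ≡ true → RowReached R K w
        cols  : ∀ v → K v ≡ true → ColReached R K v
        tight : ∀ w → R w ≡ true → out x w ≤ lo w
        full  : ∀ v → K v ≡ true → hi v ≤ inn x v
    open Visited

    weaken-row : ∀ {R K R′ K′ w} → (∀ i → R′ i ≡ false → R i ≡ false) → (∀ i → K′ i ≡ false → K i ≡ false) →
                 RowReached R K w → RowReached R′ K′ w
    weaken-row r c rr = record { RowReached rr; agree = λ where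
      i j (inj₁ p) → RowReached.agree rr i j (inj₁ (r i p))
      i j (inj₂ p) → RowReached.agree rr i j (inj₂ (c j p)) }

    weaken-col : ∀ {R K R′ K′ w} → (∀ i → R′ i ≡ false → R i ≡ false) → (∀ i → K′ i ≡ false → K i ≡ false) →
                 ColReached R K w → ColReached R′ K′ w
    weaken-col r c cr = record { ColReached cr; agree = λ where
      i j (inj₁ p) → ColReached.agree cr i j (inj₁ (r i p))
      i j (inj₂ p) → ColReached.agree cr i j (inj₂ (c j p)) }

    false≢true : ∀ {p} → p ≡ false → p ≢ true
    false≢true refl ()

    reach-col : ∀ {R K w v} → R w ≡ true → RowReached R K w → K v ≡ false → E w v ≡ true → x w v ≡ false →
                ColReached R (add v K) v
    reach-col {R} {K} {w} {v} w∈R rr v∉K Ewv xwv = record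
      { y     = y′
      ; sub   = sub′
      ; agree = agree′
      ; outs  = λ i → trans (Minus-out mn i) (RowReached.outs rr i)
      ; inns  = λ j → trans (Minus-inn mn j) (cong (_+ δ j v) (RowReached.inns rr j))
      }
      where
      y  = RowReached.y rr
      y′ = set y w v true
      mn : Minus y y′ w v
      mn = set-true y w v (trans (RowReached.agree rr w v (inj₂ v∉K)) xwv)
      sub′ : y′ ⊆ E
      sub′ i j eq with i Fin.≟ w | j Fin.≟ v | eq
      ... | yes refl | yes refl | _   = Ewv
      ... | yes _    | no _     | eq′ = RowReached.sub rr i j eq′
      ... | no _     | _        | eq′ = RowReached.sub rr i j eq′
      agree′ : Agree R (add v K) y′
      agree′ i j (inj₁ p) = trans (set-agree y w v true i j (inj₁ λ { refl → false≢true p w∈R }))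
                                  (RowReached.agree rr i j (inj₁ p))
      agree′ i j (inj₂ p) = trans (set-agree y w v true i j (inj₂ λ { refl → false≢true p (∈-add v K) }))
                                  (RowReached.agree rr i j (inj₂ (⊆-add v K j p)))

    -- Dually, deleting `(w , v)` removes the extra unit at column `v` and leaves row `w` one unit
    -- short.
    reach-row : ∀ {R K w v} → K v ≡ true → ColReached R K v → R w ≡ false → x w v ≡ true →
                RowReached (add w R) K w
    reach-row {R} {K} {w} {v} v∈K cr w∉R xwv = record
      { y     = y′
      ; sub   = sub′
      ; agree = agree′
      ; outs  = λ i → trans (≡.sym (Minus-out mn i)) (ColReached.outs cr i)
      ; inns  = λ j → +-cancelʳ-≡ (δ j v) _ _ (trans (≡.sym (Minus-inn mn j)) (ColReached.inns cr j))
      }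
      where
      y  = ColReached.y cr
      y′ = set y w v false
      mn : Minus y′ y w v
      mn = set-false y w v (trans (ColReached.agree cr w v (inj₁ w∉R)) xwv)
      sub′ : y′ ⊆ E
      sub′ i j eq with i Fin.≟ w | j Fin.≟ v | eq
      ... | yes refl | yes refl | ()
      ... | yes _    | no _     | eq′ = ColReached.sub cr i j eq′
      ... | no _     | _        | eq′ = ColReached.sub cr i j eq′
      agree′ : Agree (add w R) K y′
      agree′ i j (inj₁ p) = trans (set-agree y w v false i j (inj₁ λ { refl → false≢true p (∈-add w R) }))
                                  (ColReached.agree cr i j (inj₁ (⊆-add w R i p)))
      agree′ i j (inj₂ p) = trans (set-agree y w v false i j (inj₂ λ { refl → false≢true p v∈K }))
                                  (ColReached.agree cr i j (inj₂ p))

    -- Row `u` can take one more unit because its sum is below `lo u`, hence below `hi u`.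
    out+δ≤hi : ∀ i → out x i + δ i u ≤ hi i
    out+δ≤hi i with i Fin.≟ u
    ... | yes refl = ≤-trans (≤-reflexive (+-comm _ 1)) (≤-trans deficient (lo≤hi i))
    ... | no _     = ≤-trans (≤-reflexive (+-identityʳ _)) (out≤hi fx i)

    deficit-drops : ∀ {k} → out x u + 1 ≡ k → lo u ∸ k < lo u ∸ out x u
    deficit-drops refl = ∸-monoʳ-< {m = lo u} (≤-reflexive (+-comm 1 (out x u))) (≤-trans (≤-reflexive (+-comm _ 1)) deficient)

    finish-col : ∀ {R K v} → ColReached R K v → inn x v < hi v → Improvement x u
    finish-col {v = v} cr v<hi = record
      { next     = y
      ; feasible = record
        { sub    = ColReached.sub cr
        ; out≤hi = λ i → ≤-trans (≤-reflexive (ColReached.outs cr i)) (out+δ≤hi i)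
        ; inn≤hi = λ j → ≤-trans (≤-reflexive (ColReached.inns cr j)) (inn+δ≤hi j)
        }
      ; out-def  = λ i → ∸-monoʳ-≤ (lo i) (≤-trans (m≤m+n (out x i) _) (≤-reflexive (≡.sym (ColReached.outs cr i))))
      ; out-def< = deficit-drops (trans (cong (out x u +_) (≡.sym (δ-refl u))) (≡.sym (ColReached.outs cr u)))
      ; inn-def  = λ j → ∸-monoʳ-≤ (lo j) (≤-trans (m≤m+n (inn x j) _) (≤-reflexive (≡.sym (ColReached.inns cr j))))
      }
      where
      y = ColReached.y cr
      inn+δ≤hi : ∀ j → inn x j + δ j v ≤ hi j
      inn+δ≤hi j with j Fin.≟ v
      ... | yes refl = ≤-trans (≤-reflexive (+-comm _ 1)) v<hi
      ... | no _     = ≤-trans (≤-reflexive (+-identityʳ _)) (inn≤hi fx j)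

    finish-row : ∀ {R K w} → RowReached R K w → lo w < out x w → Improvement x u
    finish-row {w = w} rr lo<w = record
      { next     = y
      ; feasible = record
        { sub    = RowReached.sub rr
        ; out≤hi = λ i → ≤-trans (m≤m+n _ (δ i w)) (≤-trans (≤-reflexive (RowReached.outs rr i)) (out+δ≤hi i))
        ; inn≤hi = λ j → ≤-trans (≤-reflexive (RowReached.inns rr j)) (inn≤hi fx j)
        }
      ; out-def  = def
      ; out-def< = deficit-drops (begin
          out x u + 1     ≡⟨ cong (out x u +_) (δ-refl u) ⟨
          out x u + δ u u ≡⟨ RowReached.outs rr u ⟨
          out y u + δ u w ≡⟨ cong (out y u +_) (δ-≢ u≢w) ⟩
          out y u + 0     ≡⟨ +-identityʳ _ ⟩
          out y u         ∎)
      ; inn-def  = λ j → ≤-reflexive (cong (lo j ∸_) (RowReached.inns rr j))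
      }
      where
      open ≡-Reasoning
      y = RowReached.y rr
      -- A row with surplus differs from the deficient row `u`, so the loss at `w` does not cancel
      -- the gain at `u`.
      u≢w : u ≢ w
      u≢w refl = <-asym lo<w deficient
      def : ∀ i → lo i ∸ out y i ≤ lo i ∸ out x i
      def i with i Fin.≟ w | RowReached.outs rr i
      ... | yes refl | eq = ≤-trans (≤-reflexive (m≤n⇒m∸n≡0 lo≤y)) z≤n
        where
        lo≤y : lo i ≤ out y i
        lo≤y = ≤-pred (≤-trans lo<w (≤-trans (m≤m+n _ _) (≤-trans (≤-reflexive (≡.sym eq)) (≤-reflexive (+-comm _ 1)))))
      ... | no _     | eq = ∸-monoʳ-≤ (lo i) (≤-trans (m≤m+n (out x i) _) (≤-trans (≤-reflexive (≡.sym eq)) (≤-reflexive (+-identityʳ _))))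

    RowExit ColExit : (R K : Fin n → Bool) → Fin n → Fin n → Set
    RowExit R K w v = R w ≡ true × K v ≡ false × E w v ≡ true × x w v ≡ false
    ColExit R K w v = K v ≡ true × R w ≡ false × x w v ≡ true

    rowExit? : ∀ R K → Dec (∃₂ (RowExit R K))
    rowExit? R K = Finₚ.any? λ w → Finₚ.any? λ v →
      (R w Boolₚ.≟ true) ×-dec (K v Boolₚ.≟ false) ×-dec (E w v Boolₚ.≟ true) ×-dec (x w v Boolₚ.≟ false)

    colExit? : ∀ R K → Dec (∃₂ (ColExit R K))
    colExit? R K = Finₚ.any? λ w → Finₚ.any? λ v →
      (K v Boolₚ.≟ true) ×-dec (R w Boolₚ.≟ false) ×-dec (x w v Boolₚ.≟ true)

    -- Without exits, every pair of `x` in a column of `K` has its row in `R`, and every pair of `E`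
    -- from `R` to a column outside `K` is in `x`. As the columns of `K` are full, the rows of `R`
    -- carry at least the right side of the cut condition at `K` and `R`. Tightness and the
    -- deficient `u` make their total strictly less than the left side.
    closed-absurd : ∀ {R K} → Visited R K → ¬ ∃₂ (RowExit R K) → ¬ ∃₂ (ColExit R K) → ∀ {A : Set} → A
    closed-absurd {R} {K} vis noRow noCol = contradiction (≤-trans below (≤-trans (cut K R) loose)) (<-irrefl refl)
      where
      open ≤-Reasoning
      below : Σℕ n (λ w → bit (R w) * out x w) < Σℕ n (λ w → bit (R w) * lo w)
      below = Σ-mono-< n le u lt
        where
        le : ∀ w → bit (R w) * out x w ≤ bit (R w) * lo w
        le w with R w in eq
        ... | true  = *-monoʳ-≤ 1 (tight vis w eq)
        ... | false = z≤n
        lt : bit (R u) * out x u < bit (R u) * lo u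
        lt rewrite root vis = *-monoʳ-< 1 deficient
      arcs : ∀ w v → bit (K v) * bit (x w v) + bit (R w) * bit (E w v) * bit (not (K v)) ≤ bit (R w) * bit (x w v)
      arcs w v with R w in eqR | K v in eqK | E w v in eqE | x w v in eqx
      ... | false | true  | _     | true  = contradiction (w , v , eqK , eqR , eqx) noCol
      ... | false | true  | _     | false = z≤n
      ... | false | false | _     | _     = z≤n
      ... | true  | true  | true  | true  = ≤-refl
      ... | true  | true  | false | true  = ≤-refl
      ... | true  | true  | true  | false = z≤n
      ... | true  | true  | false | false = z≤n
      ... | true  | false | false | _     = z≤n
      ... | true  | false | true  | true  = ≤-refl
      ... | true  | false | true  | false = contradiction (w , v , eqR , eqK , eqE , eqx) noRow
      full′ : ∀ v → bit (K v) * hi v ≤ bit (K v) * inn x v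
      full′ v with K v in eq
      ... | true  = *-monoʳ-≤ 1 (full vis v eq)
      ... | false = z≤n
      leaving = Σℕ n (λ w → Σℕ n (λ v → bit (R w) * bit (E w v) * bit (not (K v))))
      loose : Σℕ n (λ v → bit (K v) * hi v) + leaving ≤ Σℕ n (λ w → bit (R w) * out x w)
      loose = begin
        Σℕ n (λ v → bit (K v) * hi v) + leaving
          ≤⟨ +-monoˡ-≤ leaving (Σ-mono-≤ n full′) ⟩
        Σℕ n (λ v → bit (K v) * inn x v) + leaving
          ≡⟨ cong (_+ leaving) (Σ-cong n (λ v → Σ-*ˡ n (bit (K v)) _)) ⟨
        Σℕ n (λ v → Σℕ n (λ w → bit (K v) * bit (x w v))) + leaving
          ≡⟨ cong (_+ leaving) (Σ-swap n n (λ v w → bit (K v) * bit (x w v))) ⟩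
        Σℕ n (λ w → Σℕ n (λ v → bit (K v) * bit (x w v))) + leaving
          ≡⟨ ΣΣ-+ n _ _ ⟨
        Σℕ n (λ w → Σℕ n (λ v → bit (K v) * bit (x w v) + bit (R w) * bit (E w v) * bit (not (K v))))
          ≤⟨ Σ-mono-≤ n (λ w → Σ-mono-≤ n (arcs w)) ⟩
        Σℕ n (λ w → Σℕ n (λ v → bit (R w) * bit (x w v)))
          ≡⟨ Σ-cong n (λ w → Σ-*ˡ n (bit (R w)) _) ⟩
        Σℕ n (λ w → bit (R w) * out x w) ∎

    -- Following an exit either reaches a column with room or a row with surplus, which finishes the
    -- path, or enlarges `K` or `R`. The number of unreached rows and columns therefore bounds the
    -- search.
    search : ∀ {R K} → Visited R K → Acc _<_ (∣ R ∣ᶜ + ∣ K ∣ᶜ) → Improvement x u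
    search {R} {K} vis (acc rec) with rowExit? R K
    ... | yes (w , v , w∈R , v∉K , Ewv , xwv) = extend (inn x v <? hi v)
      where
      reached : ColReached R (add v K) v
      reached = reach-col w∈R (rows vis w w∈R) v∉K Ewv xwv
      extend : Dec (inn x v < hi v) → Improvement x u
      extend (yes lt) = finish-col reached lt
      extend (no ¬lt) = search vis′ (rec (+-monoʳ-< ∣ R ∣ᶜ (∣add∣ᶜ v K v∉K)))
        where
        cols′ : ∀ j → j ≡ v ⊎ K j ≡ true → ColReached R (add v K) j
        cols′ j (inj₁ refl) = reached
        cols′ j (inj₂ j∈K)  = weaken-col (λ _ p → p) (⊆-add v K) (cols vis j j∈K)
        full′ : ∀ j → j ≡ v ⊎ K j ≡ true → hi j ≤ inn x j
        full′ j (inj₁ refl) = ≮⇒≥ ¬lt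
        full′ j (inj₂ j∈K)  = full vis j j∈K
        vis′ : Visited R (add v K)
        vis′ = record
          { root = root vis
          ; rows  = λ i i∈R → weaken-row (λ _ p → p) (⊆-add v K) (rows vis i i∈R)
          ; cols  = λ j j∈ → cols′ j (∈-add⁻ v K j j∈)
          ; tight = tight vis
          ; full  = λ j j∈ → full′ j (∈-add⁻ v K j j∈)
          }
    ... | no noRow with colExit? R K
    ... | no noCol = closed-absurd vis noRow noCol
    ... | yes (w , v , v∈K , w∉R , xwv) = extend (lo w <? out x w)
      where
      reached : RowReached (add w R) K w
      reached = reach-row v∈K (cols vis v v∈K) w∉R xwv
      extend : Dec (lo w < out x w) → Improvement x u
      extend (yes lt) = finish-row reached lt
      extend (no ¬lt) = search vis′ (rec (+-monoˡ-< ∣ K ∣ᶜ (∣add∣ᶜ w R w∉R)))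
        where
        rows′ : ∀ i → i ≡ w ⊎ R i ≡ true → RowReached (add w R) K i
        rows′ i (inj₁ refl) = reached
        rows′ i (inj₂ i∈R)  = weaken-row (⊆-add w R) (λ _ p → p) (rows vis i i∈R)
        tight′ : ∀ i → i ≡ w ⊎ R i ≡ true → out x i ≤ lo i
        tight′ i (inj₁ refl) = ≮⇒≥ ¬lt
        tight′ i (inj₂ i∈R)  = tight vis i i∈R
        root′ : add w R u ≡ true
        root′ with u Fin.≟ w
        ... | yes _ = refl
        ... | no _  = root vis
        vis′ : Visited (add w R) K
        vis′ = record
          { root = root′
          ; rows  = λ i i∈ → rows′ i (∈-add⁻ w R i i∈)
          ; cols  = λ j j∈K → weaken-col (⊆-add w R) (λ _ p → p) (cols vis j j∈K)
          ; tight = λ i i∈ → tight′ i (∈-add⁻ w R i i∈)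
          ; full  = full vis
          }

    improve : Improvement x u
    improve = search vis₀ (<-wellFounded _)
      where
      only-u : ∀ {i} → i ≡ u ⊎ false ≡ true → i ≡ u
      only-u (inj₁ eq) = eq
      reached : ∀ i → i ≡ u → RowReached (add u λ _ → false) (λ _ → false) i
      -- The trivial path: for `w` equal to `u` the gain and the loss in `outs` cancel, so `x`
      -- itself is the witness.
      reached i refl = record
        { y = x ; sub = Feasible.sub fx ; agree = λ _ _ _ → refl ; outs = λ _ → refl ; inns = λ _ → refl }
      vis₀ : Visited (add u λ _ → false) (λ _ → false)
      vis₀ = record
        { root = ∈-add u _
        ; rows  = λ i i∈ → reached i (only-u (∈-add⁻ u _ i i∈))
        ; cols  = λ _ ()
        ; tight = λ i i∈ → subst (λ k → out x k ≤ lo k) (≡.sym (only-u (∈-add⁻ u _ i i∈))) (<⇒≤ deficient)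
        ; full  = λ _ ()
        }

-- From single repairs to a factor

module _ {n : ℕ} (E : Rel n) (lo hi : Fin n → ℕ) (lo≤hi : ∀ i → lo i ≤ hi i) where
  private
    module A  = Augment E lo hi lo≤hi
    module Aᵀ = Augment (E ᵀ) lo hi lo≤hi

  Feasible-ᵀ : ∀ {x} → A.Feasible x → Aᵀ.Feasible (x ᵀ)
  Feasible-ᵀ fx = record { sub = λ u v → A.sub fx v u ; out≤hi = A.inn≤hi fx ; inn≤hi = A.out≤hi fx }

  Feasible-ᵀ⁻ : ∀ {x} → Aᵀ.Feasible x → A.Feasible (x ᵀ)
  Feasible-ᵀ⁻ fx = record { sub = λ u v → Aᵀ.sub fx v u ; out≤hi = Aᵀ.inn≤hi fx ; inn≤hi = Aᵀ.out≤hi fx }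

  deficit : (Fin n → ℕ) → ℕ
  deficit d = Σℕ n (λ i → lo i ∸ d i)

  Factor : Set
  Factor = Σ (Rel n) λ x → A.Feasible x × (∀ i → lo i ≤ out x i) × (∀ i → lo i ≤ inn x i)

  -- The total deficit of rows and columns is the potential. Repairing a row lowers it without
  -- increasing any column deficit; a column is repaired as a row of the transpose.
  cutCondition⇒factor : A.CutCondition → Aᵀ.CutCondition → Factor
  cutCondition⇒factor cut cutᵀ = go (λ _ _ → false) empty (<-wellFounded _)
    where
    empty : A.Feasible (λ _ _ → false)
    empty = record { sub = λ _ _ () ; out≤hi = zeros ; inn≤hi = zeros }
      where
      zeros : ∀ i → Σℕ n (λ _ → 0) ≤ hi i
      zeros i = ≤-trans (≤-reflexive (Σ-zero n)) z≤n
    go : ∀ x → A.Feasible x → Acc _<_ (deficit (out x) + deficit (inn x)) → Factor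
    go x fx (acc rec) with Finₚ.any? (λ u → out x u <? lo u)
    ... | yes (u , lt) = go (A.next imp) (A.feasible imp)
            (rec (+-mono-<-≤ (Σ-mono-< n (A.out-def imp) u (A.out-def< imp)) (Σ-mono-≤ n (A.inn-def imp))))
      where imp = A.Search.improve cut x fx u lt
    ... | no noRow with Finₚ.any? (λ u → inn x u <? lo u)
    ... | yes (u , lt) = go (Aᵀ.next imp ᵀ) (Feasible-ᵀ⁻ (Aᵀ.feasible imp))
            (rec (+-mono-≤-< (Σ-mono-≤ n (Aᵀ.inn-def imp)) (Σ-mono-< n (Aᵀ.out-def imp) u (Aᵀ.out-def< imp))))
      where imp = Aᵀ.Search.improve cutᵀ (x ᵀ) (Feasible-ᵀ fx) u lt
    ... | no noCol = x , fx , (λ i → ≮⇒≥ (λ lt → noRow (i , lt))) , (λ i → ≮⇒≥ (λ lt → noCol (i , lt)))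

-- Counting edges

2*nC2+n≡n*n : ∀ n → 2 * (n C 2) + n ≡ n * n
2*nC2+n≡n*n zero    = refl
2*nC2+n≡n*n (suc n) = begin
  2 * (suc n C 2) + suc n         ≡⟨ cong (λ c → 2 * c + suc n) (nCk+nC[k+1]≡[n+1]C[k+1] n 1) ⟨
  2 * (n C 1 + n C 2) + suc n     ≡⟨ cong (λ c → 2 * (c + n C 2) + suc n) (nC1≡n n) ⟩
  2 * (n + n C 2) + suc n         ≡⟨ expand n (n C 2) ⟩
  (2 * (n C 2) + n) + (2 * n + 1) ≡⟨ cong (_+ (2 * n + 1)) (2*nC2+n≡n*n n) ⟩
  n * n + (2 * n + 1)             ≡⟨ square n ⟩
  suc n * suc n                   ∎
  where
  open ≡-Reasoning
  expand : ∀ n c → 2 * (n + c) + suc n ≡ (2 * c + n) + (2 * n + 1)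
  expand = solve-∀
  square : ∀ n → n * n + (2 * n + 1) ≡ suc n * suc n
  square = solve-∀

-- The format for linear arithmetic below: a sum of known inequalities gives `p ≤ q`, and ring
-- identities show that it is the desired inequality with the common terms `z` added to both sides.
≤-cancel-both : ∀ z {p q x y} → p ≤ q → p ≡ x + z → q ≡ y + z → x ≤ y
≤-cancel-both z {x = x} {y} p≤q refl refl = +-cancelʳ-≤ z x y p≤q

-- In the notation of the header, |S| = s, |T| = b + 1 + k, n = |S| + |T| + r,
-- c = (n − b − 1) C 2, e = e(G) and D = Σ_{v∈T} d_{G−S}(v).
module Counting (a b m k s r e c D : ℕ)
  (2≤a : 2 ≤ a) (a≤b : a ≤ b) (1≤m : 1 ≤ m) (m≤b : m ≤ b)
  (order : 8 * a + 5 * b + 8 * m + 14 ≤ 2 * (s + (b + 1 + k) + r))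
  (binom : 2 * c + (k + s + r) ≡ (k + s + r) * (k + s + r))
  (edges : c + a * b + 2 * a + (b + 1) * m ≤ e)
  (upper : 2 * e + (s + r) ≤ (s + r) * (s + r) + 2 * (D + (b + 1 + k) * s))
  (defect : b * s + 1 + D ≤ a * (b + 1 + k) + 2 * m)
  where

  -- Adding `binom`, twice `edges`, `upper` and twice `defect` eliminates `c`, `e` and `D`. The
  -- quadratic terms left over are those of (k + s + r)² - (s + r)², whose part 2ks cancels against
  -- `upper`.
  main : 2 * (r * k) + k * k + 2 * a + 2 * ((b + 1) * m) + 2 ≤ k + 2 * (a * k) + 4 * m + 2 * s
  main = ≤-cancel-both z (+-mono-≤ (+-mono-≤ (≤-reflexive (≡.sym binom)) (*-monoʳ-≤ 2 edges))
                                   (+-mono-≤ upper (*-monoʳ-≤ 2 defect)))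
           (lhs a b m k s r e c D) (rhs a b m k s r e c D)
    where
    z = 2 * c + 2 * e + 2 * D + 2 * (b * s) + 2 * (a * b) + 2 * a + s + r + (s + r) * (s + r) + 2 * (k * s)
    lhs : ∀ a b m k s r e c D →
      (k + s + r) * (k + s + r) + 2 * (c + a * b + 2 * a + (b + 1) * m) + ((2 * e + (s + r)) + 2 * (b * s + 1 + D)) ≡
      2 * (r * k) + k * k + 2 * a + 2 * ((b + 1) * m) + 2 +
      (2 * c + 2 * e + 2 * D + 2 * (b * s) + 2 * (a * b) + 2 * a + s + r + (s + r) * (s + r) + 2 * (k * s))
    lhs = solve-∀
    rhs : ∀ a b m k s r e c D →
      2 * c + (k + s + r) + 2 * e + (((s + r) * (s + r) + 2 * (D + (b + 1 + k) * s)) + 2 * (a * (b + 1 + k) + 2 * m)) ≡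
      k + 2 * (a * k) + 4 * m + 2 * s +
      (2 * c + 2 * e + 2 * D + 2 * (b * s) + 2 * (a * b) + 2 * a + s + r + (s + r) * (s + r) + 2 * (k * s))
    rhs = solve-∀

  defect′ : b * s + 1 ≤ a * (b + 1 + k) + 2 * m
  defect′ = ≤-trans (m≤m+n _ D) defect

  -- By `a ≤ b` and `m ≤ b` the right side of `defect′` is at most b(a + k + 3), so b·s < b(a + k +
  -- 3).
  s≤a+k+2 : s ≤ a + k + 2
  s≤a+k+2 = ≮⇒≥ λ lt → <-irrefl {0} refl
    (≤-cancel-both (b * s + a * (1 + k) + 2 * m + b * (a + k + 2) + b)
      (+-mono-≤ (+-mono-≤ (*-monoʳ-≤ b lt) defect′) (+-mono-≤ (*-monoˡ-≤ (1 + k) a≤b) (*-monoʳ-≤ 2 m≤b)))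
      (lhs a b m k s) (rhs a b m k s))
    where
    lhs : ∀ a b m k s → b * suc (a + k + 2) + (b * s + 1) + (a * (1 + k) + 2 * m) ≡
          1 + (b * s + a * (1 + k) + 2 * m + b * (a + k + 2) + b)
    lhs = solve-∀
    rhs : ∀ a b m k s → b * s + (a * (b + 1 + k) + 2 * m) + (b * (1 + k) + 2 * b) ≡
          0 + (b * s + a * (1 + k) + 2 * m + b * (a + k + 2) + b)
    rhs = solve-∀

  -- Removes `m` from `main`: as b ≥ 2 and m ≥ 1, 2(b + 1)m + 2 - 4m ≥ 2m + 2 ≥ 4.
  main′ : 2 * (r * k) + k * k + 2 * a + 4 ≤ k + 2 * (a * k) + 2 * s
  main′ = ≤-cancel-both (4 * m + 2 * ((b + 1) * m) + 2 * m)
    (+-mono-≤ main (+-mono-≤ (*-monoʳ-≤ 2 (*-monoˡ-≤ m (+-monoˡ-≤ 1 (≤-trans 2≤a a≤b)))) (*-monoʳ-≤ 2 1≤m)))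
    (lhs a b m k r) (rhs a b m k s)
    where
    lhs : ∀ a b m k r → 2 * (r * k) + k * k + 2 * a + 2 * ((b + 1) * m) + 2 + (2 * ((2 + 1) * m) + 2 * 1) ≡
          2 * (r * k) + k * k + 2 * a + 4 + (4 * m + 2 * ((b + 1) * m) + 2 * m)
    lhs = solve-∀
    rhs : ∀ a b m k s → k + 2 * (a * k) + 4 * m + 2 * s + (2 * ((b + 1) * m) + 2 * m) ≡
          k + 2 * (a * k) + 2 * s + (4 * m + 2 * ((b + 1) * m) + 2 * m)
    rhs = solve-∀

  -- The order bound is multiplied by `k` so that `main′` can bound its term 2rk. Replacing `s` by
  -- its upper bound then makes the terms free of `k` cancel. For positive `k` this is a lower bound
  -- on `k`.
  k-large : k * (4 * a + 3 * b + 8 * m + 5) ≤ k * (3 * k)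
  k-large = ≤-cancel-both
    (k * k + 2 * (r * k) + 2 * a + 4 + 2 * ((1 + k) * s) + k * (4 * a + 7 + 2 * (b + 1)))
    (+-mono-≤ (+-mono-≤ (*-monoʳ-≤ k order) main′) (*-monoʳ-≤ 2 (*-monoʳ-≤ (1 + k) s≤a+k+2)))
    (lhs a b m k s r) (rhs a b k s r)
    where
    lhs : ∀ a b m k s r →
      k * (8 * a + 5 * b + 8 * m + 14) + (2 * (r * k) + k * k + 2 * a + 4) + 2 * ((1 + k) * s) ≡
      k * (4 * a + 3 * b + 8 * m + 5) +
      (k * k + 2 * (r * k) + 2 * a + 4 + 2 * ((1 + k) * s) + k * (4 * a + 7 + 2 * (b + 1)))
    lhs = solve-∀
    rhs : ∀ a b k s r →
      k * (2 * (s + (b + 1 + k) + r)) + (k + 2 * (a * k) + 2 * s) + 2 * ((1 + k) * (a + k + 2)) ≡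
      k * (3 * k) +
      (k * k + 2 * (r * k) + 2 * a + 4 + 2 * ((1 + k) * s) + k * (4 * a + 7 + 2 * (b + 1)))
    rhs = solve-∀

  -- Dropping 2rk from `main′` and inserting the bound on `s` gives, for positive `k`, an upper
  -- bound on `k`.
  k-small : k * k ≤ k * (3 + 2 * a)
  k-small = ≤-cancel-both (2 * a + 4 + 2 * s)
    (+-mono-≤ (≤-trans (m≤n+m _ (2 * (r * k))) (≤-trans (≤-reflexive (reassoc a k (r * k))) main′))
              (*-monoʳ-≤ 2 s≤a+k+2))
    (lhs a k s) (rhs a k s)
    where
    reassoc : ∀ a k p → 2 * p + (k * k + 2 * a + 4) ≡ 2 * p + k * k + 2 * a + 4
    reassoc = solve-∀
    lhs : ∀ a k s → k * k + 2 * a + 4 + 2 * s ≡ k * k + (2 * a + 4 + 2 * s)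
    lhs = solve-∀
    rhs : ∀ a k s → k + 2 * (a * k) + 2 * s + 2 * (a + k + 2) ≡ k * (3 + 2 * a) + (2 * a + 4 + 2 * s)
    rhs = solve-∀

-- For positive `k` the two bounds on `k` are incompatible. For `k` equal to 0 they are trivial, and
-- `main` with `defect′` contradicts `a ≤ b` directly.
counting-absurd : ∀ a b m k s r e c D →
  2 ≤ a → a ≤ b → 1 ≤ m → m ≤ b →
  8 * a + 5 * b + 8 * m + 14 ≤ 2 * (s + (b + 1 + k) + r) →
  2 * c + (k + s + r) ≡ (k + s + r) * (k + s + r) →
  c + a * b + 2 * a + (b + 1) * m ≤ e →
  2 * e + (s + r) ≤ (s + r) * (s + r) + 2 * (D + (b + 1 + k) * s) →
  ¬ (b * s + 1 + D ≤ a * (b + 1 + k) + 2 * m)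
counting-absurd a b m k@(suc _) s r e c D 2≤a a≤b 1≤m m≤b order binom edges upper defect =
  contradiction (≤-trans (*-monoʳ-≤ 8 1≤m) (≤-trans (m≤n+m _ a) bound)) λ { (s≤s (s≤s (s≤s (s≤s ())))) }
  where
  open Counting a b m k s r e c D 2≤a a≤b 1≤m m≤b order binom edges upper defect
  -- After cancelling `k`: 4a + 3b + 8m + 5 ≤ 3k ≤ 9 + 6a, combined with 3a ≤ 3b.
  bound : a + 8 * m ≤ 4
  bound = ≤-cancel-both (3 * k + 3 * b + 6 * a + 5)
    (+-mono-≤ (+-mono-≤ (*-cancelˡ-≤ k k-large) (*-monoʳ-≤ 3 (*-cancelˡ-≤ k k-small))) (*-monoʳ-≤ 3 a≤b))
    (lhs a b m k) (rhs a b k)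
    where
    lhs : ∀ a b m k → 4 * a + 3 * b + 8 * m + 5 + 3 * k + 3 * a ≡ a + 8 * m + (3 * k + 3 * b + 6 * a + 5)
    lhs = solve-∀
    rhs : ∀ a b k → 3 * k + 3 * (3 + 2 * a) + 3 * b ≡ 4 + (3 * k + 3 * b + 6 * a + 5)
    rhs = solve-∀
counting-absurd a b@(suc (suc b′)) m zero s r e c D 2≤a a≤b 1≤m m≤b order binom edges upper defect =
  <-irrefl refl (≤-trans (s≤s a≤b) (≤-trans (m≤m+n _ _) b<a))
  where
  open Counting a b m zero s r e c D 2≤a a≤b 1≤m m≤b order binom edges upper defect
  -- Half of `b` times `main` plus twice `defect′`, which cancels `s`. The coefficient of `m` is (b
  -- - 2)(b + 1), written in b′ = b - 2 to show that it is nonnegative.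
  b<a : suc b + (3 * b′ + b′ * b′) * m ≤ a
  b<a = *-cancelˡ-≤ 2 (≤-cancel-both (2 * (b * s) + 2 * (a * b) + 4 * (b * m) + 4 * m)
    (+-mono-≤ (*-monoʳ-≤ b main) (*-monoʳ-≤ 2 defect′))
    (lhs a b′ m s r) (rhs a b′ m s))
    where
    lhs : ∀ a b′ m s r → let b = 2 + b′ in
      b * (2 * (r * 0) + 0 + 2 * a + 2 * ((b + 1) * m) + 2) + 2 * (b * s + 1) ≡
      2 * (suc b + (3 * b′ + b′ * b′) * m) + (2 * (b * s) + 2 * (a * b) + 4 * (b * m) + 4 * m)
    lhs = solve-∀
    rhs : ∀ a b′ m s → let b = 2 + b′ in
      b * (0 + 2 * (a * 0) + 4 * m + 2 * s) + 2 * (a * (b + 1 + 0) + 2 * m) ≡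
      2 * a + (2 * (b * s) + 2 * (a * b) + 4 * (b * m) + 4 * m)
    rhs = solve-∀
counting-absurd a (suc zero) m zero s r e c D 2≤a (s≤s z≤n) = contradiction 2≤a λ { (s≤s ()) }
counting-absurd a zero m zero s r e c D 2≤a z≤n = contradiction 2≤a λ ()

-- Degrees outside a set and a bound on e(G)

module _ {n : ℕ} (G : Graph n) where

  edge : Fin n → Fin n → ℕ
  edge u v = bit (adj G u v)

  edge-sym : ∀ u v → edge u v ≡ edge v u
  edge-sym u v = cong bit (sym G u v)

  degOutside : (Fin n → Bool) → Fin n → ℕ
  degOutside S v = Σℕ n (λ w → edge v w * bit (not (S w)))

  deg≤degOutside+∣S∣ : ∀ S v → deg G v ≤ degOutside S v + ∣ S ∣
  deg≤degOutside+∣S∣ S v = ≤-trans (Σ-mono-≤ n le) (≤-reflexive (Σ-+ n _ _))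
    where
    le : ∀ w → edge v w ≤ edge v w * bit (not (S w)) + bit (S w)
    le w with S w
    ... | true  = ≤-trans (bit≤1 (adj G v w)) (m≤n+m 1 _)
    ... | false = ≤-trans (≤-reflexive (≡.sym (*-identityʳ _))) (m≤m+n _ 0)

  -- Each edge either lies outside U or is counted by the degree of an end in U.
  numEdges-upper : ∀ (U : Fin n → Bool) → 2 * numEdges G + ∣ U ∣ᶜ ≤
    ∣ U ∣ᶜ * ∣ U ∣ᶜ + 2 * Σℕ n (λ v → bit (U v) * deg G v)
  numEdges-upper U = begin
    2 * numEdges G + M
      ≡⟨ cong₂ _+_ (handshake n edge edge-sym (λ u → cong bit (irref G u))) (Σ-cong n diag) ⟨
    Σℕ n (λ u → Σℕ n (edge u)) + Σℕ n (λ v → Σℕ n (λ u → bit (not (U v)) * δ u v))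
      ≡⟨ cong (Σℕ n (λ u → Σℕ n (edge u)) +_) (Σ-swap n n _) ⟩
    Σℕ n (λ u → Σℕ n (edge u)) + Σℕ n (λ u → Σℕ n (λ v → bit (not (U v)) * δ u v))
      ≡⟨ ΣΣ-+ n _ _ ⟨
    Σℕ n (λ u → Σℕ n (λ v → edge u v + bit (not (U v)) * δ u v))
      ≤⟨ Σ-mono-≤ n (λ u → Σ-mono-≤ n (le u)) ⟩
    Σℕ n (λ u → Σℕ n (λ v → bit (not (U u)) * bit (not (U v)) + (bit (U u) * edge u v + bit (U v) * edge v u)))
      ≡⟨ trans (ΣΣ-+ n (λ u v → bit (not (U u)) * bit (not (U v))) _)
               (cong (Σℕ n (λ u → Σℕ n (λ v → bit (not (U u)) * bit (not (U v)))) +_) (ΣΣ-+ n (λ u v → bit (U u) * edge u v) _)) ⟩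
    Σℕ n (λ u → Σℕ n (λ v → bit (not (U u)) * bit (not (U v)))) +
    (Σℕ n (λ u → Σℕ n (λ v → bit (U u) * edge u v)) + Σℕ n (λ u → Σℕ n (λ v → bit (U v) * edge v u)))
      ≡⟨ cong₂ _+_ square (cong₂ _+_ rows (trans (Σ-swap n n (λ u v → bit (U v) * edge v u)) rows)) ⟩
    M * M + (L + L)
      ≡⟨ cong (λ l → M * M + (L + l)) (+-identityʳ L) ⟨
    M * M + 2 * L ∎
    where
    open ≤-Reasoning
    M = ∣ U ∣ᶜ
    L = Σℕ n (λ v → bit (U v) * deg G v)
    -- The summand `M` is spread over the diagonal, so that the comparison can be made pair by pair:
    -- of the M² ordered pairs outside `U`, the M diagonal ones carry no edge.
    diag : ∀ v → Σℕ n (λ u → bit (not (U v)) * δ u v) ≡ bit (not (U v))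
    diag v = trans (Σ-*ˡ n (bit (not (U v))) _) (trans (cong (bit (not (U v)) *_) (Σ-δ n v)) (*-identityʳ _))
    square : Σℕ n (λ u → Σℕ n (λ v → bit (not (U u)) * bit (not (U v)))) ≡ M * M
    square = trans (Σ-cong n (λ u → trans (Σ-*ˡ n (bit (not (U u))) _) (*-comm _ M))) (Σ-*ˡ n M _)
    rows : Σℕ n (λ u → Σℕ n (λ v → bit (U u) * edge u v)) ≡ L
    rows = Σ-cong n (λ u → Σ-*ˡ n (bit (U u)) _)
    le : ∀ u v → edge u v + bit (not (U v)) * δ u v ≤
                 bit (not (U u)) * bit (not (U v)) + (bit (U u) * edge u v + bit (U v) * edge v u)
    le u v with u Fin.≟ v
    le u v | yes refl rewrite irref G u with U u
    ... | true  = z≤n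
    ... | false = ≤-refl
    le u v | no _ rewrite sym G v u with U u | U v | adj G u v
    ... | true  | true  | true  = s≤s z≤n
    ... | true  | true  | false = z≤n
    ... | true  | false | true  = ≤-refl
    ... | true  | false | false = z≤n
    ... | false | true  | true  = ≤-refl
    ... | false | true  | false = z≤n
    ... | false | false | true  = ≤-refl
    ... | false | false | false = z≤n

-- The defect inequality for dense graphs

module Dense (a b m n : ℕ) (2≤a : 2 ≤ a) (a≤b : a ≤ b) (1≤m : 1 ≤ m) (m≤b : m ≤ b)
  (G : Graph n)
  (order : 8 * a + 5 * b + 8 * m + 14 ≤ 2 * n)
  (minDeg : ∀ u → a + m ≤ deg G u)
  (dense : ((n ∸ b ∸ 1) C 2) + a * b + 2 * a + (b + 1) * m ≤ numEdges G)
  where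

  module _ (S : Fin n → Bool) where

    private
      d : Fin n → ℕ
      d = degOutside G S

    -- The set T of vertices with positive defect; on it `a ∸ d v` is an exact difference.
    low : Fin n → Bool
    low v = not (S v) ∧ (d v <ᵇ a)

    private
      s = ∣ S ∣
      t = ∣ low ∣
      F = Σℕ n (λ v → bit (low v) * (a ∸ d v))
      D = Σℕ n (λ v → bit (low v) * d v)

    low⇒< : ∀ v → low v ≡ true → d v < a
    low⇒< v eq with S v | eq
    ... | false | eq′ = <ᵇ⇒< (d v) a (subst T (≡.sym eq′) _)

    F+D≡a*t : F + D ≡ a * t
    F+D≡a*t = begin
      F + D                                                    ≡⟨ Σ-+ n _ _ ⟨
      Σℕ n (λ v → bit (low v) * (a ∸ d v) + bit (low v) * d v) ≡⟨ Σ-cong n eq ⟩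
      Σℕ n (λ v → a * bit (low v))                             ≡⟨ Σ-*ˡ n a _ ⟩
      a * t                                                    ∎
      where
      open ≡-Reasoning
      eq : ∀ v → bit (low v) * (a ∸ d v) + bit (low v) * d v ≡ a * bit (low v)
      eq v with low v in lv
      ... | true  = trans (cong₂ _+_ (*-identityˡ (a ∸ d v)) (*-identityˡ (d v)))
                          (trans (m∸n+n≡m (<⇒≤ (low⇒< v lv))) (≡.sym (*-identityʳ a)))
      ... | false = ≡.sym (*-zeroʳ a)

    -- For `v` in `low`, a + m ≤ deg v ≤ d v + s, so each defect plus `m` is at most `s`.
    F+t*m≤t*s : F + t * m ≤ t * s
    F+t*m≤t*s = begin
      F + t * m                                              ≡⟨ cong (F +_) (*-comm t m) ⟩
      F + m * t                                              ≡⟨ cong (F +_) (Σ-*ˡ n m _) ⟨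
      F + Σℕ n (λ v → m * bit (low v))                       ≡⟨ Σ-+ n _ _ ⟨
      Σℕ n (λ v → bit (low v) * (a ∸ d v) + m * bit (low v)) ≤⟨ Σ-mono-≤ n le ⟩
      Σℕ n (λ v → s * bit (low v))                           ≡⟨ Σ-*ˡ n s _ ⟩
      s * t                                                  ≡⟨ *-comm s t ⟩
      t * s                                                  ∎
      where
      open ≤-Reasoning
      le : ∀ v → bit (low v) * (a ∸ d v) + m * bit (low v) ≤ s * bit (low v)
      le v with low v in lv
      ... | false = ≤-reflexive (trans (*-zeroʳ m) (≡.sym (*-zeroʳ s)))
      ... | true  = +-cancelˡ-≤ (d v) _ _ (begin
        d v + (1 * (a ∸ d v) + m * 1) ≡⟨ cong₂ (λ p q → d v + (p + q)) (*-identityˡ _) (*-identityʳ m) ⟩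
        d v + (a ∸ d v + m)           ≡⟨ +-assoc (d v) _ m ⟨
        d v + (a ∸ d v) + m           ≡⟨ cong (_+ m) (m+[n∸m]≡n (<⇒≤ (low⇒< v lv))) ⟩
        a + m                         ≤⟨ minDeg v ⟩
        deg G v                       ≤⟨ deg≤degOutside+∣S∣ G S v ⟩
        d v + s                       ≡⟨ cong (d v +_) (*-identityʳ s) ⟨
        d v + s * 1                   ∎)

    M = ∣ low ∣ᶜ

    t+M≡n : t + M ≡ n
    t+M≡n = ∣S∣+∣S∣ᶜ≡n low

    s≤M : s ≤ M
    s≤M = Σ-mono-≤ n le
      where
      le : ∀ v → bit (S v) ≤ bit (not (low v))
      le v with S v
      ... | true  = ≤-refl
      ... | false = z≤n

    lowDeg≤ : Σℕ n (λ v → bit (low v) * deg G v) ≤ D + t * s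
    lowDeg≤ = begin
      Σℕ n (λ v → bit (low v) * deg G v)
        ≤⟨ Σ-mono-≤ n (λ v → *-monoʳ-≤ (bit (low v)) (deg≤degOutside+∣S∣ G S v)) ⟩
      Σℕ n (λ v → bit (low v) * (d v + s))
        ≡⟨ Σ-cong n (λ v → trans (*-distribˡ-+ (bit (low v)) (d v) s) (cong (bit (low v) * d v +_) (*-comm (bit (low v)) s))) ⟩
      Σℕ n (λ v → bit (low v) * d v + s * bit (low v))   ≡⟨ Σ-+ n _ _ ⟩
      D + Σℕ n (λ v → s * bit (low v))                   ≡⟨ cong (D +_) (trans (Σ-*ˡ n s _) (*-comm s t)) ⟩
      D + t * s                                          ∎
      where open ≤-Reasoning

    -- `P` stands for the sum of d_H over `S`, of which only two bounds matter. If s < m, the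
    -- minimum degree forces F = 0, and P ≤ sm ≤ bs. Otherwise F ≤ t(s - m) ≤ b(s - m), and P ≤ 2m ≤
    -- bm supplies the rest.
    few-low : ∀ P → P ≤ 2 * m → P ≤ s * m → t ≤ b → F + P ≤ b * s
    few-low P P≤2m P≤sm t≤b with m ≤? s
    ... | no m≰s = begin
      F + P     ≤⟨ +-mono-≤ F≤0 P≤sm ⟩
      s * m     ≤⟨ *-monoʳ-≤ s m≤b ⟩
      s * b     ≡⟨ *-comm s b ⟩
      b * s     ∎
      where
      open ≤-Reasoning
      F≤0 : F ≤ 0
      F≤0 = +-cancelʳ-≤ (t * m) F 0 (≤-trans F+t*m≤t*s (*-monoʳ-≤ t (<⇒≤ (≰⇒> m≰s))))
    ... | yes m≤s = begin
      F + P                 ≤⟨ +-mono-≤ F≤ P≤2m ⟩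
      t * (s ∸ m) + 2 * m   ≤⟨ +-mono-≤ (*-monoˡ-≤ (s ∸ m) t≤b) (*-monoˡ-≤ m (≤-trans 2≤a a≤b)) ⟩
      b * (s ∸ m) + b * m   ≡⟨ *-distribˡ-+ b (s ∸ m) m ⟨
      b * (s ∸ m + m)       ≡⟨ cong (b *_) (m∸n+n≡m m≤s) ⟩
      b * s                 ∎
      where
      open ≤-Reasoning
      F≤ : F ≤ t * (s ∸ m)
      F≤ = +-cancelʳ-≤ (t * m) F _ (≤-trans F+t*m≤t*s (≤-reflexive
             (trans (cong (t *_) (≡.sym (m∸n+n≡m m≤s))) (*-distribˡ-+ t (s ∸ m) m))))

    -- A failure, together with F = at - D, bounds `D` from above. `numEdges-upper` for `low` turns
    -- this into an upper bound on e(G) that `counting-absurd` refutes.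
    many-low : ∀ P → P ≤ 2 * m → b < t → F + P ≤ b * s
    many-low P P≤2m b<t = ≮⇒≥ λ lt → counting-absurd a b m k s r (numEdges G) ((n ∸ b ∸ 1) C 2) D
      2≤a a≤b 1≤m m≤b order′ binom dense upper (defect lt)
      where
      k = t ∸ suc b
      r = M ∸ s
      t≡ : t ≡ b + 1 + k
      t≡ = trans (≡.sym (m+[n∸m]≡n b<t)) (cong (_+ k) (+-comm 1 b))
      M≡ : M ≡ s + r
      M≡ = ≡.sym (m+[n∸m]≡n s≤M)
      n≡ : n ≡ s + (b + 1 + k) + r
      n≡ = trans (≡.sym t+M≡n) (trans (cong₂ _+_ t≡ M≡) (shuffle (b + 1 + k) s r))
        where
        shuffle : ∀ x y z → x + (y + z) ≡ y + x + z
        shuffle = solve-∀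
      order′ : 8 * a + 5 * b + 8 * m + 14 ≤ 2 * (s + (b + 1 + k) + r)
      order′ = subst (λ n → 8 * a + 5 * b + 8 * m + 14 ≤ 2 * n) n≡ order
      N≡ : n ∸ b ∸ 1 ≡ k + s + r
      N≡ = begin
        n ∸ b ∸ 1                     ≡⟨ ∸-+-assoc n b 1 ⟩
        n ∸ (b + 1)                   ≡⟨ cong (_∸ (b + 1)) (trans n≡ (shuffle (b + 1) k s r)) ⟩
        (b + 1) + (k + s + r) ∸ (b + 1) ≡⟨ m+n∸m≡n (b + 1) _ ⟩
        k + s + r                     ∎
        where
        open ≡-Reasoning
        shuffle : ∀ x k s r → s + (x + k) + r ≡ x + (k + s + r)
        shuffle = solve-∀
      binom : 2 * ((n ∸ b ∸ 1) C 2) + (k + s + r) ≡ (k + s + r) * (k + s + r)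
      binom = subst (λ N → 2 * ((n ∸ b ∸ 1) C 2) + N ≡ N * N) N≡ (2*nC2+n≡n*n (n ∸ b ∸ 1))
      upper : 2 * numEdges G + (s + r) ≤ (s + r) * (s + r) + 2 * (D + (b + 1 + k) * s)
      upper = begin
        2 * numEdges G + (s + r)                   ≡⟨ cong (2 * numEdges G +_) M≡ ⟨
        2 * numEdges G + M                         ≤⟨ numEdges-upper G low ⟩
        M * M + 2 * Σℕ n (λ v → bit (low v) * deg G v) ≤⟨ +-monoʳ-≤ (M * M) (*-monoʳ-≤ 2 lowDeg≤) ⟩
        M * M + 2 * (D + t * s)                    ≡⟨ cong₂ (λ x y → x * x + 2 * (D + y * s)) M≡ t≡ ⟩
        (s + r) * (s + r) + 2 * (D + (b + 1 + k) * s) ∎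
        where open ≤-Reasoning
      defect : b * s < F + P → b * s + 1 + D ≤ a * (b + 1 + k) + 2 * m
      defect lt = begin
        b * s + 1 + D           ≡⟨ cong (_+ D) (+-comm (b * s) 1) ⟩
        suc (b * s) + D         ≤⟨ +-monoˡ-≤ D lt ⟩
        F + P + D               ≡⟨ shuffle F P D ⟩
        F + D + P               ≤⟨ +-mono-≤ (≤-reflexive (trans F+D≡a*t (cong (a *_) t≡))) P≤2m ⟩
        a * (b + 1 + k) + 2 * m ∎
        where
        open ≤-Reasoning
        shuffle : ∀ x y z → x + y + z ≡ x + z + y
        shuffle = solve-∀

    defect-bound : ∀ P → P ≤ 2 * m → P ≤ s * m → F + P ≤ b * s
    defect-bound P P≤2m P≤sm with t ≤? b
    ... | yes t≤b = few-low P P≤2m P≤sm t≤b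
    ... | no t≰b  = many-low P P≤2m (≰⇒> t≰b)

-- The indicator function

abstract
  -- The indicator function takes only the values 0, 1/2 and 1. Writing them as halves of naturals
  -- reduces rational sums and comparisons to natural ones.
  half : ℕ → ℚ
  half k = ℤ.+ k ℚ./ 2

  toℚᵘ-half : ∀ k → ℚ.toℚᵘ (half k) ℚᵘ.≃ mkℚᵘ (ℤ.+ k) 1
  toℚᵘ-half k = ℚₚ.toℚᵘ-fromℚᵘ (mkℚᵘ (ℤ.+ k) 1)

  half-+ : ∀ j k → half j ℚ.+ half k ≡ half (j + k)
  half-+ j k = ℚₚ.toℚᵘ-injective (begin-equality
    ℚ.toℚᵘ (half j ℚ.+ half k)              ≃⟨ ℚₚ.toℚᵘ-homo-+ (half j) (half k) ⟩
    ℚ.toℚᵘ (half j) ℚᵘ.+ ℚ.toℚᵘ (half k)    ≃⟨ ℚᵘₚ.+-cong (toℚᵘ-half j) (toℚᵘ-half k) ⟩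
    mkℚᵘ (ℤ.+ j) 1 ℚᵘ.+ mkℚᵘ (ℤ.+ k) 1
      ≃⟨ *≡* (trans (cong (ℤ._* ℤ.+ 2) (≡.sym (ℤₚ.*-distribʳ-+ (ℤ.+ 2) (ℤ.+ j) (ℤ.+ k)))) (ℤₚ.*-assoc (ℤ.+ (j + k)) (ℤ.+ 2) (ℤ.+ 2))) ⟩
    mkℚᵘ (ℤ.+ (j + k)) 1                      ≃⟨ toℚᵘ-half (j + k) ⟨
    ℚ.toℚᵘ (half (j + k))                   ∎)
    where open ℚᵘₚ.≤-Reasoning

  half-mono : ∀ {j k} → j ≤ k → half j ℚ.≤ half k
  half-mono {j} {k} j≤k = ℚₚ.toℚᵘ-cancel-≤ (begin
    ℚ.toℚᵘ (half j) ≃⟨ toℚᵘ-half j ⟩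
    mkℚᵘ (ℤ.+ j) 1    ≤⟨ *≤* (ℤₚ.*-monoʳ-≤-nonNeg (ℤ.+ 2) (ℤ.+≤+ j≤k)) ⟩
    mkℚᵘ (ℤ.+ k) 1    ≃⟨ toℚᵘ-half k ⟨
    ℚ.toℚᵘ (half k) ∎)
    where open ℚᵘₚ.≤-Reasoning

  half-2* : ∀ k → half (2 * k) ≡ ℤ.+ k ℚ./ 1
  half-2* k = ℚₚ.fromℚᵘ-cong {mkℚᵘ (ℤ.+ (2 * k)) 1} {mkℚᵘ (ℤ.+ k) 0}
    (*≡* (trans (ℤₚ.*-identityʳ (ℤ.+ (2 * k))) (trans (cong ℤ.+_ (*-comm 2 k)) (ℤₚ.pos-* k 2))))

  half-0 : half 0 ≡ 0ℚ
  half-0 = refl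

  half-2 : half 2 ≡ 1ℚ
  half-2 = refl

Σℚ-cong : ∀ n {f g : Fin n → ℚ} → (∀ i → f i ≡ g i) → Σℚ n f ≡ Σℚ n g
Σℚ-cong zero    eq = refl
Σℚ-cong (suc n) eq = cong₂ ℚ._+_ (eq zero) (Σℚ-cong n (λ i → eq (suc i)))

Σℚ-half : ∀ n (f : Fin n → ℕ) → Σℚ n (λ i → half (f i)) ≡ half (Σℕ n f)
Σℚ-half zero    f = ≡.sym half-0
Σℚ-half (suc n) f = trans (cong (half (f zero) ℚ.+_) (Σℚ-half n (λ i → f (suc i)))) (half-+ (f zero) _)

-- Degrees in H and the graph G - E(H)

module _ {n : ℕ} {G : Graph n} (H : SubgraphEdges G) where

  hadj-irref : ∀ u → hadj H u u ≡ false
  hadj-irref u with hadj H u u | hsub H u u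
  ... | false | _ = refl
  ... | true  | p = contradiction (subst T (irref G u) (p _)) λ ()

  degH : Fin n → ℕ
  degH = out (hadj H)

  Σ-degH : Σℕ n degH ≡ 2 * numSubEdges H
  Σ-degH = handshake n (λ u v → bit (hadj H u v)) (λ u v → cong bit (hsym H u v)) (λ u → cong bit (hadj-irref u))

  -- In the degree sum 2e(H), row `v` contributes d_H(v), and the entries in column `v` of the other
  -- rows contribute d_H(v) once more.
  degH≤numSubEdges : ∀ v → degH v ≤ numSubEdges H
  degH≤numSubEdges v = *-cancelˡ-≤ 2 (begin
    2 * degH v                                           ≡⟨ cong (degH v +_) (+-identityʳ _) ⟩
    degH v + degH v
      ≡⟨ cong (degH v +_) (trans (cong (degH v *_) (Σ-δ n v)) (*-identityʳ _)) ⟨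
    degH v + degH v * Σℕ n (λ u → δ u v)                 ≡⟨ cong (degH v +_) (Σ-*ˡ n (degH v) _) ⟨
    degH v + Σℕ n (λ u → degH v * δ u v)                 ≡⟨ Σ-+ n _ _ ⟨
    Σℕ n (λ u → bit (hadj H v u) + degH v * δ u v)       ≤⟨ Σ-mono-≤ n le ⟩
    Σℕ n degH                                            ≡⟨ Σ-degH ⟩
    2 * numSubEdges H                                    ∎)
    where
    open ≤-Reasoning
    le : ∀ u → bit (hadj H v u) + degH v * δ u v ≤ degH u
    le u with u Fin.≟ v
    ... | yes refl rewrite hadj-irref u = ≤-reflexive (*-identityʳ _)
    ... | no _ = begin
      bit (hadj H v u) + degH v * 0 ≡⟨ cong₂ _+_ (cong bit (hsym H v u)) (*-zeroʳ (degH v)) ⟩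
      bit (hadj H u v) + 0          ≡⟨ +-identityʳ _ ⟩
      bit (hadj H u v)              ≤⟨ term≤Σ n (λ w → bit (hadj H u w)) v ⟩
      degH u                        ∎

  rest : Rel n
  rest u v = adj G u v ∧ not (hadj H u v)

  rest-sym : ∀ u v → rest u v ≡ rest v u
  rest-sym u v = cong₂ (λ p q → p ∧ not q) (sym G u v) (hsym H u v)

  edge≡rest+hadj : ∀ u v → bit (adj G u v) ≡ bit (rest u v) + bit (hadj H u v)
  edge≡rest+hadj u v with adj G u v | hadj H u v | hsub H u v
  ... | true  | true  | _ = refl
  ... | true  | false | _ = refl
  ... | false | true  | p = contradiction (p _) λ ()
  ... | false | false | _ = refl

-- Moving S ∩ U out of both sets does not increase the slack of the cut condition when lo ≤ hi.
disjoint-cut⇒cut : ∀ {n} (E : Rel n) → (∀ u v → E u v ≡ E v u) →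
  (lo hi : Fin n → ℕ) (lo≤hi : ∀ i → lo i ≤ hi i) →
  (∀ (S U : Fin n → Bool) → (∀ v → U v ≡ true → S v ≡ false) →
    Σℕ n (λ v → bit (U v) * lo v) ≤
    Σℕ n (λ v → bit (S v) * hi v) + Σℕ n (λ v → Σℕ n (λ w → bit (U v) * bit (E v w) * bit (not (S w))))) →
  Augment.CutCondition E lo hi lo≤hi
disjoint-cut⇒cut {n} E E-sym lo hi lo≤hi disjoint S U = begin
  Σℕ n (λ v → bit (U v) * lo v)
    ≤⟨ Σ-mono-≤ n splitU ⟩
  Σℕ n (λ v → bit (U′ v) * lo v + bit (Q v) * hi v)
    ≡⟨ Σ-+ n _ _ ⟩
  Σℕ n (λ v → bit (U′ v) * lo v) + q
    ≤⟨ +-monoˡ-≤ q (disjoint S′ U′ disj) ⟩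
  Σℕ n (λ v → bit (S′ v) * hi v) + cross U′ (λ w → not (S′ w)) + q
    ≡⟨ shuffle (Σℕ n (λ v → bit (S′ v) * hi v)) _ q ⟩
  Σℕ n (λ v → bit (S′ v) * hi v) + q + cross U′ (λ w → not (S′ w))
    ≤⟨ +-mono-≤ (≤-reflexive (trans (≡.sym (Σ-+ n _ _)) (Σ-cong n splitS))) cross≤ ⟩
  Σℕ n (λ v → bit (S v) * hi v) + cross U (λ w → not (S w)) ∎
  where
  open ≤-Reasoning
  S′ U′ Q : Fin n → Bool
  S′ v = S v ∧ not (U v)
  U′ v = U v ∧ not (S v)
  Q v = S v ∧ U v
  q = Σℕ n (λ v → bit (Q v) * hi v)
  cross : (A B : Fin n → Bool) → ℕ
  cross A B = Σℕ n (λ v → Σℕ n (λ w → bit (A v) * bit (E v w) * bit (B w)))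
  shuffle : ∀ x y z → x + y + z ≡ x + z + y
  shuffle = solve-∀
  disj : ∀ v → U′ v ≡ true → S′ v ≡ false
  disj v with S v | U v
  ... | true  | true  = λ ()
  ... | true  | false = λ ()
  ... | false | _     = λ _ → refl
  splitU : ∀ v → bit (U v) * lo v ≤ bit (U′ v) * lo v + bit (Q v) * hi v
  splitU v with S v | U v
  ... | true  | true  = *-monoʳ-≤ 1 (lo≤hi v)
  ... | true  | false = z≤n
  ... | false | true  = m≤m+n _ _
  ... | false | false = z≤n
  splitS : ∀ v → bit (S′ v) * hi v + bit (Q v) * hi v ≡ bit (S v) * hi v
  splitS v with S v | U v
  ... | true  | true  = refl
  ... | true  | false = +-identityʳ _
  ... | false | _     = refl
  cross-swap : ∀ A B → cross A B ≡ cross B A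
  cross-swap A B = trans (Σ-swap n n _) (Σ-cong n λ w → Σ-cong n λ v →
    trans (cong (λ p → bit (A v) * bit p * bit (B w)) (E-sym v w)) (rev (bit (A v)) (bit (E w v)) (bit (B w))))
    where
    rev : ∀ x y z → x * y * z ≡ z * y * x
    rev = solve-∀
  -- Passing from `S` to `S′` adds the pairs from `U′` to `Q`. By symmetry of `E` they may be
  -- counted from `Q` to `U′`, hence as pairs from `U` to the outside of `S`; they start in `Q` and
  -- so differ from those starting in `U′`.
  cross≤ : cross U′ (λ w → not (S′ w)) ≤ cross U (λ w → not (S w))
  cross≤ = begin
    cross U′ (λ w → not (S′ w))
      ≡⟨ trans (Σ-cong n λ v → Σ-cong n λ w → splitCol v w) (ΣΣ-+ n _ _) ⟩
    cross U′ (λ w → not (S w)) + cross U′ Q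
      ≡⟨ cong (cross U′ (λ w → not (S w)) +_) (cross-swap U′ Q) ⟩
    cross U′ (λ w → not (S w)) + cross Q U′
      ≡⟨ ΣΣ-+ n _ _ ⟨
    Σℕ n (λ v → Σℕ n (λ w → bit (U′ v) * bit (E v w) * bit (not (S w)) + bit (Q v) * bit (E v w) * bit (U′ w)))
      ≤⟨ Σ-mono-≤ n (λ v → Σ-mono-≤ n (merge v)) ⟩
    cross U (λ w → not (S w)) ∎
    where
    splitCol : ∀ v w → bit (U′ v) * bit (E v w) * bit (not (S′ w)) ≡
                       bit (U′ v) * bit (E v w) * bit (not (S w)) + bit (U′ v) * bit (E v w) * bit (Q w)
    splitCol v w = trans (cong (bit (U′ v) * bit (E v w) *_) col) (*-distribˡ-+ (bit (U′ v) * bit (E v w)) _ _)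
      where
      col : bit (not (S′ w)) ≡ bit (not (S w)) + bit (Q w)
      col with S w | U w
      ... | true  | true  = refl
      ... | true  | false = refl
      ... | false | _     = refl
    merge : ∀ v w → bit (U′ v) * bit (E v w) * bit (not (S w)) + bit (Q v) * bit (E v w) * bit (U′ w) ≤
                    bit (U v) * bit (E v w) * bit (not (S w))
    merge v w with S v | U v | S w | U w | E v w
    ... | true  | false | _     | _     | _     = z≤n
    ... | false | false | _     | _     | _     = z≤n
    ... | true  | true  | true  | true  | true  = z≤n
    ... | true  | true  | true  | true  | false = z≤n
    ... | true  | true  | true  | false | true  = z≤n
    ... | true  | true  | true  | false | false = z≤n
    ... | true  | true  | false | true  | true  = ≤-refl
    ... | true  | true  | false | true  | false = z≤n
    ... | true  | true  | false | false | true  = z≤n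
    ... | true  | true  | false | false | false = z≤n
    ... | false | true  | _     | _     | _     = ≤-reflexive (+-identityʳ _)

-- Construction of the covering fractional factor

module Covered (a b m n : ℕ) (2≤a : 2 ≤ a) (a≤b : a ≤ b) (1≤m : 1 ≤ m) (m≤b : m ≤ b)
  (G : Graph n)
  (order : 8 * a + 5 * b + 8 * m + 14 ≤ 2 * n)
  (minDeg : ∀ u → a + m ≤ deg G u)
  (dense : ((n ∸ b ∸ 1) C 2) + a * b + 2 * a + (b + 1) * m ≤ numEdges G)
  (H : SubgraphEdges G) (∣H∣≡m : numSubEdges H ≡ m)
  where

  open Dense a b m n 2≤a a≤b 1≤m m≤b G order minDeg dense

  -- What remains to be supplied once `h` is 1 on `H`. Truncation in `lo` is genuine, as d_H(v) may
  -- exceed `a`; `hi` is exact because d_H(v) ≤ m ≤ b.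
  lo hi : Fin n → ℕ
  lo v = a ∸ degH H v
  hi v = b ∸ degH H v

  lo≤hi : ∀ v → lo v ≤ hi v
  lo≤hi v = ∸-monoˡ-≤ (degH H v) a≤b

  degH≤m : ∀ v → degH H v ≤ m
  degH≤m v = ≤-trans (degH≤numSubEdges H v) (≤-reflexive ∣H∣≡m)

  hi+degH : ∀ v → hi v + degH H v ≡ b
  hi+degH v = m∸n+n≡m (≤-trans (degH≤m v) m≤b)

  -- Deleting H costs `v` at most d_H(v) of its degree outside `S`, so `lo v` is at most the defect
  -- of `v` plus its remaining edges leaving `S`. Summed over `U`, the defects total at most `F`,
  -- and `defect-bound` gives F ≤ b|S| - P, the sum of `hi` over `S`.
  disjoint-cut : ∀ (S U : Fin n → Bool) → (∀ v → U v ≡ true → S v ≡ false) →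
    Σℕ n (λ v → bit (U v) * lo v) ≤
    Σℕ n (λ v → bit (S v) * hi v) + Σℕ n (λ v → Σℕ n (λ w → bit (U v) * bit (rest H v w) * bit (not (S w))))
  disjoint-cut S U disj = begin
    Σℕ n (λ v → bit (U v) * lo v)
      ≤⟨ Σ-mono-≤ n vertex ⟩
    Σℕ n (λ v → bit (low S v) * (a ∸ degOutside G S v) + Σℕ n (λ w → bit (U v) * bit (rest H v w) * bit (not (S w))))
      ≡⟨ Σ-+ n _ _ ⟩
    F + crossing
      ≤⟨ +-monoˡ-≤ crossing F≤hi ⟩
    Σℕ n (λ v → bit (S v) * hi v) + crossing ∎
    where
    open ≤-Reasoning
    F = Σℕ n (λ v → bit (low S v) * (a ∸ degOutside G S v))
    P = Σℕ n (λ v → bit (S v) * degH H v)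
    crossing = Σℕ n (λ v → Σℕ n (λ w → bit (U v) * bit (rest H v w) * bit (not (S w))))
    P≤2m : P ≤ 2 * m
    P≤2m = begin
      P                 ≤⟨ Σ-mono-≤ n (λ v → ≤-trans (*-monoˡ-≤ (degH H v) (bit≤1 (S v))) (≤-reflexive (*-identityˡ _))) ⟩
      Σℕ n (degH H)     ≡⟨ Σ-degH H ⟩
      2 * numSubEdges H ≡⟨ cong (2 *_) ∣H∣≡m ⟩
      2 * m             ∎
    P≤sm : P ≤ ∣ S ∣ * m
    P≤sm = begin
      P
        ≤⟨ Σ-mono-≤ n (λ v → ≤-trans (*-monoʳ-≤ (bit (S v)) (degH≤m v)) (≤-reflexive (*-comm (bit (S v)) m))) ⟩
      Σℕ n (λ v → m * bit (S v))   ≡⟨ Σ-*ˡ n m _ ⟩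
      m * ∣ S ∣                  ≡⟨ *-comm m _ ⟩
      ∣ S ∣ * m                  ∎
    weights : ∀ v → b * bit (S v) ≡ bit (S v) * hi v + bit (S v) * degH H v
    weights v = trans (*-comm b _) (trans (cong (bit (S v) *_) (≡.sym (hi+degH v)))
                                          (*-distribˡ-+ (bit (S v)) (hi v) (degH H v)))
    F≤hi : F ≤ Σℕ n (λ v → bit (S v) * hi v)
    F≤hi = +-cancelʳ-≤ P F _ (begin
      F + P                                                    ≤⟨ defect-bound S P P≤2m P≤sm ⟩
      b * ∣ S ∣                                              ≡⟨ Σ-*ˡ n b _ ⟨
      Σℕ n (λ v → b * bit (S v))
        ≡⟨ Σ-cong n weights ⟩
      Σℕ n (λ v → bit (S v) * hi v + bit (S v) * degH H v)     ≡⟨ Σ-+ n _ _ ⟩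
      Σℕ n (λ v → bit (S v) * hi v) + P                        ∎)
    degOutside≤ : ∀ v → degOutside G S v ≤ Σℕ n (λ w → bit (rest H v w) * bit (not (S w))) + degH H v
    degOutside≤ v = ≤-trans (Σ-mono-≤ n le) (≤-reflexive (Σ-+ n _ _))
      where
      le : ∀ w → bit (adj G v w) * bit (not (S w)) ≤ bit (rest H v w) * bit (not (S w)) + bit (hadj H v w)
      le w = begin
        bit (adj G v w) * bit (not (S w))                              ≡⟨ cong (_* bit (not (S w))) (edge≡rest+hadj H v w) ⟩
        (bit (rest H v w) + bit (hadj H v w)) * bit (not (S w))        ≡⟨ *-distribʳ-+ (bit (not (S w))) (bit (rest H v w)) _ ⟩
        bit (rest H v w) * bit (not (S w)) + bit (hadj H v w) * bit (not (S w))
          ≤⟨ +-monoʳ-≤ (bit (rest H v w) * bit (not (S w))) (≤-trans (*-monoʳ-≤ (bit (hadj H v w)) (bit≤1 (not (S w)))) (≤-reflexive (*-identityʳ _))) ⟩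
        bit (rest H v w) * bit (not (S w)) + bit (hadj H v w) ∎
    lo≤ : ∀ v → lo v ≤ (a ∸ degOutside G S v) + Σℕ n (λ w → bit (rest H v w) * bit (not (S w)))
    lo≤ v = m≤n+o⇒m∸n≤o a (degH H v) (begin
      a                              ≤⟨ m≤n+m∸n a d ⟩
      d + (a ∸ d)                    ≤⟨ +-monoˡ-≤ (a ∸ d) (degOutside≤ v) ⟩
      d′ + degH H v + (a ∸ d)        ≡⟨ shuffle d′ (degH H v) (a ∸ d) ⟩
      degH H v + ((a ∸ d) + d′)      ∎)
      where
      d = degOutside G S v
      d′ = Σℕ n (λ w → bit (rest H v w) * bit (not (S w)))
      shuffle : ∀ x y z → x + y + z ≡ y + (z + x)
      shuffle = solve-∀
    -- A vertex outside both `S` and `low` has degree at least `a` outside `S`, so its truncated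
    -- defect is 0.
    low-defect : ∀ v → S v ≡ false → a ∸ degOutside G S v ≤ bit (low S v) * (a ∸ degOutside G S v)
    low-defect v Sv rewrite Sv with degOutside G S v <ᵇ a in eq
    ... | true  = ≤-reflexive (≡.sym (+-identityʳ _))
    ... | false = ≤-reflexive (m≤n⇒m∸n≡0 (≮⇒≥ {degOutside G S v} {a} λ lt → subst T eq (<⇒<ᵇ lt)))
    vertex : ∀ v → bit (U v) * lo v ≤
      bit (low S v) * (a ∸ degOutside G S v) + Σℕ n (λ w → bit (U v) * bit (rest H v w) * bit (not (S w)))
    vertex v with U v in Uv
    ... | false = z≤n
    ... | true  = begin
      1 * lo v       ≡⟨ *-identityˡ (lo v) ⟩
      lo v           ≤⟨ lo≤ v ⟩
      (a ∸ degOutside G S v) + Σℕ n (λ w → bit (rest H v w) * bit (not (S w)))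
        ≤⟨ +-mono-≤ (low-defect v (disj v Uv)) (≤-reflexive (Σ-cong n λ w → cong (_* bit (not (S w))) (≡.sym (*-identityˡ (bit (rest H v w)))))) ⟩
      bit (low S v) * (a ∸ degOutside G S v) + Σℕ n (λ w → 1 * bit (rest H v w) * bit (not (S w))) ∎

  cut : Augment.CutCondition (rest H) lo hi lo≤hi
  cut = disjoint-cut⇒cut (rest H) (rest-sym H) lo hi lo≤hi disjoint-cut

  cutᵀ : Augment.CutCondition (rest H ᵀ) lo hi lo≤hi
  cutᵀ S U = ≤-trans (cut S U) (≤-reflexive (cong (Σℕ n (λ v → bit (S v) * hi v) +_)
    (Σ-cong n λ v → Σ-cong n λ w → cong (λ p → bit (U v) * bit p * bit (not (S w))) (rest-sym H v w))))

  open Augment (rest H) lo hi lo≤hi using (Feasible; sub; out≤hi; inn≤hi)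

  abstract
    factor : Factor (rest H) lo hi lo≤hi
    factor = cutCondition⇒factor (rest H) lo hi lo≤hi cut cutᵀ

  x : Rel n
  x = proj₁ factor

  x-feasible : Feasible x
  x-feasible = proj₁ (proj₂ factor)

  -- Twice the indicator function. Since `x` is supported off `H`, at most one of the two summands
  -- is nonzero, which keeps `y` at most 2.
  y : Fin n → Fin n → ℕ
  y u v = 2 * bit (hadj H u v) + (bit (x u v) + bit (x v u))

  y-sym : ∀ u v → y u v ≡ y v u
  y-sym u v = cong₂ (λ p q → 2 * bit p + q) (hsym H u v) (+-comm (bit (x u v)) _)

  x∉rest : ∀ u v → rest H u v ≡ false → x u v ≡ false
  x∉rest u v eq with x u v in xuv
  ... | false = refl
  ... | true  = trans (≡.sym (sub x-feasible u v xuv)) eq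

  y-outside-rest : ∀ u v → rest H u v ≡ false → y u v ≡ 2 * bit (hadj H u v)
  y-outside-rest u v eq rewrite x∉rest u v eq | x∉rest v u (trans (rest-sym H v u) eq) = +-identityʳ _

  y-on-H : ∀ u v → hadj H u v ≡ true → y u v ≡ 2
  y-on-H u v eq = trans (y-outside-rest u v (trans (cong (λ p → adj G u v ∧ not p) eq) (Boolₚ.∧-zeroʳ _)))
                        (cong (λ p → 2 * bit p) eq)

  y≤2 : ∀ u v → y u v ≤ 2
  y≤2 u v with hadj H u v in eq
  ... | false = +-mono-≤ (bit≤1 (x u v)) (bit≤1 (x v u))
  ... | true  = ≤-reflexive (trans (cong (λ p → 2 * bit p + (bit (x u v) + bit (x v u))) (≡.sym eq)) (y-on-H u v eq))

  y-off-G : ∀ u v → adj G u v ≡ false → y u v ≡ 0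
  y-off-G u v eq = trans (y-outside-rest u v (cong (_∧ not (hadj H u v)) eq)) (cong (2 *_) (bit≡0))
    where
    bit≡0 : bit (hadj H u v) ≡ 0
    bit≡0 = m+n≡0⇒n≡0 (bit (rest H u v)) (trans (≡.sym (edge≡rest+hadj H u v)) (cong bit eq))

  f : IndicatorFunction G
  f = record
    { h     = λ u v → half (y u v)
    ; h-sym = λ u v → cong half (y-sym u v)
    ; h-lo  = λ u v _ → ℚₚ.≤-trans (ℚₚ.≤-reflexive (≡.sym half-0)) (half-mono z≤n)
    ; h-hi  = λ u v _ → ℚₚ.≤-trans (half-mono (y≤2 u v)) (ℚₚ.≤-reflexive half-2)
    }

  Σ-y : ∀ u → Σℕ n (y u) ≡ (degH H u + out x u) + (degH H u + inn x u)
  Σ-y u = begin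
    Σℕ n (y u)                                 ≡⟨ Σ-+ n _ _ ⟩
    Σℕ n (λ v → 2 * bit (hadj H u v)) + Σℕ n (λ v → bit (x u v) + bit (x v u))
                                               ≡⟨ cong₂ _+_ (Σ-*ˡ n 2 _) (Σ-+ n _ _) ⟩
    2 * degH H u + (out x u + inn x u)         ≡⟨ shuffle (degH H u) (out x u) (inn x u) ⟩
    (degH H u + out x u) + (degH H u + inn x u) ∎
    where
    open ≡-Reasoning
    shuffle : ∀ d p q → 2 * d + (p + q) ≡ (d + p) + (d + q)
    shuffle = solve-∀

  -- `y` vanishes on non-edges of `G`, so restricting the sum to incident edges changes nothing.
  hSum-f : ∀ u → hSum f u ≡ half (Σℕ n (y u))
  hSum-f u = trans (Σℚ-cong n eq) (Σℚ-half n (y u))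
    where
    eq : ∀ v → (if adj G u v then half (y u v) else 0ℚ) ≡ half (y u v)
    eq v with adj G u v in uv
    ... | true  = refl
    ... | false = ≡.sym (trans (cong half (y-off-G u v uv)) half-0)

  -- The row sum and the column sum of `x` at `u`, each increased by d_H(u), are both at least `a`;
  -- averaging them gives the sum of `h`.
  2a≤Σy : ∀ u → 2 * a ≤ Σℕ n (y u)
  2a≤Σy u = begin
    2 * a                                        ≡⟨ cong (a +_) (+-identityʳ a) ⟩
    a + a
      ≤⟨ +-mono-≤ (a≤ (proj₁ (proj₂ (proj₂ factor)) u)) (a≤ (proj₂ (proj₂ (proj₂ factor)) u)) ⟩
    (degH H u + out x u) + (degH H u + inn x u)  ≡⟨ Σ-y u ⟨
    Σℕ n (y u)                                   ∎
    where
    open ≤-Reasoning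
    a≤ : ∀ {k} → lo u ≤ k → a ≤ degH H u + k
    a≤ lo≤k = ≤-trans (m≤n+m∸n a (degH H u)) (+-monoʳ-≤ (degH H u) lo≤k)

  Σy≤2b : ∀ u → Σℕ n (y u) ≤ 2 * b
  Σy≤2b u = begin
    Σℕ n (y u)                                   ≡⟨ Σ-y u ⟩
    (degH H u + out x u) + (degH H u + inn x u)  ≤⟨ +-mono-≤ (≤b (out≤hi x-feasible u)) (≤b (inn≤hi x-feasible u)) ⟩
    b + b                                        ≡⟨ cong (b +_) (+-identityʳ b) ⟨
    2 * b                                        ∎
    where
    open ≤-Reasoning
    ≤b : ∀ {k} → k ≤ hi u → degH H u + k ≤ b
    ≤b k≤hi = ≤-trans (+-monoʳ-≤ (degH H u) k≤hi) (≤-reflexive (trans (+-comm (degH H u) _) (hi+degH u)))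

  f-factor : IsFractionalFactor G a b f
  f-factor u = ℚₚ.≤-trans (ℚₚ.≤-reflexive (≡.sym (half-2* a))) (ℚₚ.≤-trans (half-mono (2a≤Σy u)) (ℚₚ.≤-reflexive (≡.sym (hSum-f u))))
             , ℚₚ.≤-trans (ℚₚ.≤-reflexive (hSum-f u)) (ℚₚ.≤-trans (half-mono (Σy≤2b u)) (ℚₚ.≤-reflexive (half-2* b)))

  f-covers : ∀ u v → T (hadj H u v) → h f u v ≡ 1ℚ
  f-covers u v uv = trans (cong half (y-on-H u v (T⇒≡true uv))) half-2
    where
    T⇒≡true : ∀ {p} → T p → p ≡ true
    T⇒≡true {true} _ = refl

-- The bound on `n` is doubled to clear the fraction 5b/2; it also makes `n ∸ b ∸ 1` an exact
-- difference.
theorem1p3 : (a b m n : ℕ) → 2 ≤ a → a ≤ b → 1 ≤ m → m ≤ b →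
    (G : Graph n) → Connected G →
    8 * a + 5 * b + 8 * m + 14 ≤ 2 * n →
    (∀ u → a + m ≤ deg G u) →
    ((n ∸ b ∸ 1) C 2) + a * b + 2 * a + (b + 1) * m ≤ numEdges G →
    FractionalCovered G a b m
theorem1p3 a b m n 2≤a a≤b 1≤m m≤b G _ order minDeg dense H ∣H∣≡m = f , f-factor , f-covers
  where open Covered a b m n 2≤a a≤b 1≤m m≤b G order minDeg dense H ∣H∣≡m
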